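{- Let $H$ be the hypergraph with nodes $0,1,2,3$ and edges $x_0,x_1,x_2,x_3$ of types $t(x_0)=\{0,1\}$, $t(x_1)=\{1,2\}$, $t(x_2)=\{2,3\}$, $t(x_3)=\{3,0\}$ (a square). Then there exists a symmetric electoral system $P=\nu x_0\,\nu x_1\,\nu x_2\,\nu x_3\,(P_0\,|\,P_1\,|\,P_2\,|\,P_3)$ in the mixed-choice $\pi$-calculus $\pi_m$ such that $H(P)=H$.
   Context: **Calculus.** Fix a countable set $\mathcal N$ of names $x,y,\ldots$. The mixed-choice $\pi$-calculus $\pi_m$ has prefixes $\alpha ::= x(y)\mid \bar x y\mid\tau$ (input, output, silent) and processes $P ::= \sum_i\alpha_i.P_i\mid \nu x\,P\mid P|P\mid\, !P$, where the sums are finite; $\mathbf 0$ is the empty sum. The operators $\nu x$ and $y(x).$ bind $x$; $\mathrm{fn}(P)$ is the set of free names of $P$; $P\{y/x\}$ is capture-avoiding renaming; $\equiv_\alpha$ is identity up to alpha-conversion. $P_0|P_1|\cdots|P_{k-1}$ associates to the left. **Semantics.** Actions are $\mu::= xy\mid\bar x y\mid\bar x(y)\mid\tau$ (input, free output, bound output, silent); $\mathrm{bn}(\bar x(y))=\{y\}$ and $\mathrm{bn}(\mu)=\emptyset$ otherwise; $\mathrm n(\mu)$ is the set of names occurring in $\mu$. $\equiv$ is the congruence given by alpha-conversion and $(\nu x P)|Q\equiv\nu x(P|Q)$ if $x\notin\mathrm{fn}(Q)$. Transitions are generated by the rules: (I-Sum) $\sum_i\alpha_i.P_i\xrightarrow{xy}P_j\{y/z\}$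 if $\alpha_j=x(z)$; (O/$\tau$-Sum) $\sum_i\alpha_i.P_i\xrightarrow{\alpha_j}P_j$ if $\alpha_j$ is $\bar xy$ or $\tau$; (Open) if $P\xrightarrow{\bar xy}P'$ and $x\ne y$ then $\nu yP\xrightarrow{\bar x(y)}P'$; (Res) if $P\xrightarrow{\mu}P'$ and $y\notin \mathrm n(\mu)$ then $\nu yP\xrightarrow{\mu}\nu yP'$; (Par) if $P\xrightarrow{\mu}P'$ and $\mathrm{bn}(\mu)\cap\mathrm{fn}(Q)=\emptyset$ then $P|Q\xrightarrow{\mu}P'|Q$; (Com) if $P\xrightarrow{xy}P'$ and $Q\xrightarrow{\bar xy}Q'$ then $P|Q\xrightarrow{\tau}P'|Q'$; (Close) if $P\xrightarrow{xy}P'$, $Q\xrightarrow{\bar x(y)}Q'$ and $y\notin\mathrm{fn}(P)$ then $P|Q\xrightarrow{\tau}\nu y(P'|Q')$; (Rep) if $P\,|\,!P\xrightarrow{\mu}P'$ then $!P\xrightarrow{\mu}P'$; (Cong) if $P'\equiv P$, $P\xrightarrow{\mu}Q$, $Q\equiv Q'$ then $P'\xrightarrow{\mu}Q'$; together with the symmetric versions of Par, Com, Close. **Networks.** A network is a process $P=\nu x_0\cdots\nu x_{r-1}(P_0|P_1|\cdots|P_{k-1})$ together with the specification of the top-level bound names $x_0,\ldots,x_{r-1}$ and of its $k$ components $P_0,\ldots,P_{k-1}$; it is written $[P_0|\cdots|P_{k-1}]$. Bound-names convention: the bound names in the $P_i$ are different from each other, from $x_0,\ldots,x_{r-1}$ and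 from all free names. There is a special free channel name $\mathit{out}$, used for communicating with the external world and not used by processes to communicate with each other. A special subset of $\mathcal N$ is in one-to-one correspondence with, and denoted by, the natural numbers; these names serve as identifiers of components and are not used as bound names. **Computations.** A computation $C$ of a network is a finite (possibly empty) or $\omega$-infinite sequence of transitions $[P_0|\cdots|P_{k-1}]\xrightarrow{\mu^0}[P^1_0|\cdots|P^1_{k-1}]\xrightarrow{\mu^1}\cdots$, where at each step Cong is used as needed to keep the bound-names convention and the network form with $k$ components (moving restrictions to the top level). A computation $C'$ extends $C$ if $C'=C$, or $C$ is finite and $C'$ is $C$ followed by a non-empty finite or infinite computation. The projection $\mathrm{Proj}(C,i)$ is the sequence of the steps contributed by component $i$: for each transition of $C$, with its proof tree, if the tree contains a node $P^m_i\xrightarrow{\mu}R$ then this step is contributed; otherwise nothing is contributed. **Electoral system.** $P=[P_0|\cdots|P_{k-1}]$ is an electoral system if for every computation $C$ of $P$ there exist an extension $C'$ of $C$ and $n\in\{0,\ldots,k-1\}$ (the leader) such that for each $i\in\{0,\ldots,k-1\}$ the projection $\mathrm{Proj}(C',i)$ contains one output action of the form $\overline{\mathit{out}}\,n$, and no extension of $C'$ contains any other action of the form $\overline{\mathit{out}}\,m$ with $m\ne n$. **Hypergraph, automorphisms, symmetry.** A hypergraph $\langle N,X,t\rangle$ has finite sets $N$ of nodes and $X$ of edges and a map $t$ assigning to each edge a set of nodes. The hypergraph $H(P)$ associated to a network $P$ has $N=\{0,\ldots,k-1\}$, $X=\mathrm{fn}(P_0|\cdots|P_{k-1})\setminus\{\mathit{out}\}$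 and $t(x)=\{n\mid x\in\mathrm{fn}(P_n)\}$. An automorphism of a hypergraph is a pair $\sigma=\langle\sigma_N,\sigma_X\rangle$ of permutations of $N$ and $X$ such that $t(\sigma_X(x))=\sigma_N(t(x))$ for all $x\in X$. An automorphism on the network $P$ is an automorphism of $H(P)$ such that $\sigma_X(n)=\sigma_N(n)$ for every $n\in N\cap X$ and, for each $x\in X$, $x\in\{x_0,\ldots,x_{r-1}\}$ iff $\sigma_X(x)\in\{x_0,\ldots,x_{r-1}\}$ (top-level bound names). Write $\sigma$ for both $\sigma_N$ and $\sigma_X$. For a process $Q$, $\sigma(Q)$ is obtained by first renaming all bound names to fresh ones, extending $\sigma$ to be the identity on these new names (and on names outside $N\cup X$), and then applying $\sigma$ to all names by structural induction. For an automorphism $\sigma$ on $P$, $P$ is symmetric with respect to $\sigma$ if $P_{\sigma(i)}\equiv_\alpha\sigma(P_i)$ for every node $i$; $P$ is symmetric if it is symmetric with respect to all the automorphisms on $H(P)$.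
   Formalization: H(P)=H is impossible literally, since electoral systems have free identifiers, which are edges of H(P); it is read as: H(P) without the identifier edges 0–3 is H, and every automorphism of H extends to one on P. Sums are taken up to reordering of summands. -}

module Defs where

open import Data.Bool using (Bool; true; false; if_then_else_)
open import Data.Fin using (Fin; zero; suc; toℕ; fromℕ<)
open import Data.Fin.Patterns using (0F; 1F; 2F; 3F)
open import Data.Fin.Permutation using (Permutation; Permutation′; _⟨$⟩ʳ_)
open import Data.Fin.Subset using (Subset; ⁅_⁆; _∪_; ⊥) renaming (_∈_ to _∈ˢ_)
open import Data.List using (List; []; _∷_; _++_; map; concat; filter; replicate; allFin)
import Data.List as List
open import Data.List.Membership.Propositional using (_∈_; _∉_)
import Data.List.Membership.DecPropositional as DecMembership
open import Data.List.Relation.Binary.Disjoint.Propositional using (Disjoint)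
open import Data.List.Relation.Unary.Unique.Propositional using (Unique)
open import Data.Maybe using (Maybe; just; nothing)
open import Data.Nat using (ℕ; zero; suc; _∸_; _⊔_; _<?_)
import Data.Nat as ℕ
open import Data.Product using (Σ; Σ-syntax; ∃; ∃-syntax; ∃!; _×_; _,_; proj₁; proj₂)
open import Data.Vec using (Vec; lookup; foldl₁; toList; tabulate)
open import Function using (_∘_; id)
open import Function.Bundles using (_⇔_)
open import Relation.Binary.Construct.Closure.ReflexiveTransitive using (Star; ε; _◅_)
open import Relation.Binary.Definitions using (DecidableEquality)
open import Relation.Binary.PropositionalEquality using (_≡_; _≢_; refl; cong)
open import Relation.Nullary using (yes; no; does; ¬?)
open import Relation.Nullary.Decidable using (map′)

------------------------------------------------------------------------
-- Names

-- Only ordinary names (`Var`) occur in binding position: the identifiers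
-- are never used as bound names, and `out` is always free.

Var : Set
Var = ℕ

data Name : Set where
  ident : ℕ → Name
  out   : Name
  var   : Var → Name

infix 4 _≟_

_≟_ : DecidableEquality Name
ident m ≟ ident n = map′ (cong ident) (λ { refl → refl }) (m ℕ.≟ n)
ident _ ≟ out     = no λ ()
ident _ ≟ var _   = no λ ()
out     ≟ ident _ = no λ ()
out     ≟ out     = yes refl
out     ≟ var _   = no λ ()
var _   ≟ ident _ = no λ ()
var _   ≟ out     = no λ ()
var x   ≟ var y   = map′ (cong var) (λ { refl → refl }) (x ℕ.≟ y)

open DecMembership _≟_ public using (_∈?_; _∉?_)

-- An ordinary name not in the given list.
fresh : List Name → Var
fresh []             = 0
fresh (var x ∷ xs)   = suc x ⊔ fresh xs
fresh (ident _ ∷ xs) = fresh xs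
fresh (out ∷ xs)     = fresh xs

------------------------------------------------------------------------
-- Processes

data Prefix : Set where
  _⟨_⟩ⁱ : Name → Var → Prefix
  _⟨_⟩ᵒ : Name → Name → Prefix
  τ     : Prefix

infix  8 _⟨_⟩ⁱ _⟨_⟩ᵒ
infixl 6 _∣_
infixr 7 !_

data Proc : Set where
  ∑   : ∀ {n} → (Fin n → Prefix) → (Fin n → Proc) → Proc
  ν   : Var → Proc → Proc
  _∣_ : Proc → Proc → Proc
  !_  : Proc → Proc

remove : Var → List Name → List Name
remove x = filter (λ y → ¬? (y ≟ var x))

fnPrefixed : Prefix → List Name → List Name
fnPrefixed (x ⟨ y ⟩ⁱ) ns = x ∷ remove y ns
fnPrefixed (x ⟨ y ⟩ᵒ) ns = x ∷ y ∷ ns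
fnPrefixed τ          ns = ns

fn : Proc → List Name
fn (∑ α P) = concat (List.tabulate λ i → fnPrefixed (α i) (fn (P i)))
fn (ν x P) = remove x (fn P)
fn (P ∣ Q) = fn P ++ fn Q
fn (! P)   = fn P

boundPrefix : Prefix → List Var
boundPrefix (_ ⟨ y ⟩ⁱ) = y ∷ []
boundPrefix _          = []

-- One entry per binding occurrence.
bound : Proc → List Var
bound (∑ α P) = concat (List.tabulate λ i → boundPrefix (α i) ++ bound (P i))
bound (ν x P) = x ∷ bound P
bound (P ∣ Q) = bound P ++ bound Q
bound (! P)   = bound P

------------------------------------------------------------------------
-- Renaming

infixl 9 _[_↦_]

_[_↦_] : (Name → Name) → Var → Name → Name → Name
(f [ x ↦ y ]) z = if does (z ≟ var x) then y else f z

renPrefix : List Name → (Name → Name) → Prefix → Prefix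
renPrefix av f (x ⟨ y ⟩ⁱ) = f x ⟨ fresh av ⟩ⁱ
renPrefix av f (x ⟨ y ⟩ᵒ) = f x ⟨ f y ⟩ᵒ
renPrefix av f τ          = τ

underPrefix : List Name → (Name → Name) → Prefix → List Name × (Name → Name)
underPrefix av f (x ⟨ y ⟩ⁱ) = var (fresh av) ∷ av , f [ y ↦ var (fresh av) ]
underPrefix av f _          = av , f

-- `ren av f P` replaces the free names of P according to f and every bound
-- name by one fresh for `av` and for the enclosing binders.  It is
-- capture-avoiding as long as `av` contains the f-images of the free names
-- of P.

ren : List Name → (Name → Name) → Proc → Proc
ren av f (∑ α P) = ∑ (λ i → renPrefix av f (α i))
                     (λ i → ren (proj₁ (underPrefix av f (α i)))
                                (proj₂ (underPrefix av f (α i))) (P i))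
ren av f (ν x P) = ν (fresh av) (ren (var (fresh av) ∷ av) (f [ x ↦ var (fresh av) ]) P)
ren av f (P ∣ Q) = ren av f P ∣ ren av f Q
ren av f (! P)   = ! ren av f P

infixl 9 _[_/_]

_[_/_] : Proc → Name → Var → Proc
P [ y / x ] = ren (y ∷ fn P) (id [ x ↦ y ]) P

------------------------------------------------------------------------
-- Alpha-conversion

-- `Γ` lists the pairs of bound names in scope on the two sides, innermost
-- first.  A finite sum is a family over an unordered index set, hence the
-- bijection between the indices.

Scope : Set
Scope = List (Var × Var)

infix 4 _⊢_≈ₙ_ _⊢_≈ₚ_⊣_ _⊢_≈_ _≡α_

data _⊢_≈ₙ_ : Scope → Name → Name → Set where
  free  : ∀ {a} → [] ⊢ a ≈ₙ a
  here  : ∀ {Γ x y} → (x , y) ∷ Γ ⊢ var x ≈ₙ var y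
  there : ∀ {Γ x y a b} → a ≢ var x → b ≢ var y → Γ ⊢ a ≈ₙ b → (x , y) ∷ Γ ⊢ a ≈ₙ b

-- The last argument is the scope of the continuations.
data _⊢_≈ₚ_⊣_ : Scope → Prefix → Prefix → Scope → Set where
  input  : ∀ {Γ a b x y} → Γ ⊢ a ≈ₙ b → Γ ⊢ a ⟨ x ⟩ⁱ ≈ₚ b ⟨ y ⟩ⁱ ⊣ (x , y) ∷ Γ
  output : ∀ {Γ a b c d} → Γ ⊢ a ≈ₙ b → Γ ⊢ c ≈ₙ d → Γ ⊢ a ⟨ c ⟩ᵒ ≈ₚ b ⟨ d ⟩ᵒ ⊣ Γ
  silent : ∀ {Γ} → Γ ⊢ τ ≈ₚ τ ⊣ Γ

data _⊢_≈_ : Scope → Proc → Proc → Set where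
  sum : ∀ {Γ m n} {α : Fin m → Prefix} {P : Fin m → Proc}
          {β : Fin n → Prefix} {Q : Fin n → Proc}
        (π : Permutation m n) (Δ : Fin m → Scope) →
        (∀ i → Γ ⊢ α i ≈ₚ β (π ⟨$⟩ʳ i) ⊣ Δ i) →
        (∀ i → Δ i ⊢ P i ≈ Q (π ⟨$⟩ʳ i)) →
        Γ ⊢ ∑ α P ≈ ∑ β Q
  res : ∀ {Γ x y P Q} → (x , y) ∷ Γ ⊢ P ≈ Q → Γ ⊢ ν x P ≈ ν y Q
  par : ∀ {Γ P P′ Q Q′} → Γ ⊢ P ≈ P′ → Γ ⊢ Q ≈ Q′ → Γ ⊢ P ∣ Q ≈ P′ ∣ Q′
  rep : ∀ {Γ P Q} → Γ ⊢ P ≈ Q → Γ ⊢ ! P ≈ ! Q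

_≡α_ : Proc → Proc → Set
P ≡α Q = [] ⊢ P ≈ Q

------------------------------------------------------------------------
-- Structural congruence

infix 4 _≅_

data _≅_ : Proc → Proc → Set where
  alpha   : ∀ {P Q} → P ≡α Q → P ≅ Q
  extrude : ∀ {x P Q} → var x ∉ fn Q → ν x P ∣ Q ≅ ν x (P ∣ Q)
  ≅-refl  : ∀ {P} → P ≅ P
  ≅-sym   : ∀ {P Q} → P ≅ Q → Q ≅ P
  ≅-trans : ∀ {P Q R} → P ≅ Q → Q ≅ R → P ≅ R
  ∑-cong  : ∀ {n} {α : Fin n → Prefix} {P Q : Fin n → Proc} →
            (∀ i → P i ≅ Q i) → ∑ α P ≅ ∑ α Q
  ν-cong  : ∀ {x P Q} → P ≅ Q → ν x P ≅ ν x Q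
  ∣-cong  : ∀ {P P′ Q Q′} → P ≅ P′ → Q ≅ Q′ → P ∣ Q ≅ P′ ∣ Q′
  !-cong  : ∀ {P Q} → P ≅ Q → ! P ≅ ! Q

------------------------------------------------------------------------
-- Transitions

data Action : Set where
  inᵃ   : Name → Name → Action
  outᵃ  : Name → Name → Action
  boutᵃ : Name → Var → Action
  τᵃ    : Action

bn : Action → List Name
bn (boutᵃ x y) = var y ∷ []
bn _           = []

names : Action → List Name
names (inᵃ x y)   = x ∷ y ∷ []
names (outᵃ x y)  = x ∷ y ∷ []
names (boutᵃ x y) = x ∷ var y ∷ []
names τᵃ          = []

subject : Action → Maybe Name
subject (inᵃ x _)   = just x
subject (outᵃ x _)  = just x
subject (boutᵃ x _) = just x
subject τᵃ          = nothing

infix 3 _—[_]→_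

-- The elements are the proof trees.
data _—[_]→_ : Proc → Action → Proc → Set where
  I-Sum  : ∀ {n} {α : Fin n → Prefix} {P : Fin n → Proc} {x z} j y →
           α j ≡ x ⟨ z ⟩ⁱ → ∑ α P —[ inᵃ x y ]→ P j [ y / z ]
  O-Sum  : ∀ {n} {α : Fin n → Prefix} {P : Fin n → Proc} {x y} j →
           α j ≡ x ⟨ y ⟩ᵒ → ∑ α P —[ outᵃ x y ]→ P j
  τ-Sum  : ∀ {n} {α : Fin n → Prefix} {P : Fin n → Proc} j →
           α j ≡ τ → ∑ α P —[ τᵃ ]→ P j
  Open   : ∀ {P P′ x y} → P —[ outᵃ x (var y) ]→ P′ → x ≢ var y →
           ν y P —[ boutᵃ x y ]→ P′
  Res    : ∀ {P P′ μ y} → P —[ μ ]→ P′ → var y ∉ names μ → ν y P —[ μ ]→ ν y P′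
  Parˡ   : ∀ {P P′ Q μ} → P —[ μ ]→ P′ → Disjoint (bn μ) (fn Q) → P ∣ Q —[ μ ]→ P′ ∣ Q
  Parʳ   : ∀ {P Q Q′ μ} → Q —[ μ ]→ Q′ → Disjoint (bn μ) (fn P) → P ∣ Q —[ μ ]→ P ∣ Q′
  Comˡ   : ∀ {P P′ Q Q′ x y} → P —[ inᵃ x y ]→ P′ → Q —[ outᵃ x y ]→ Q′ →
           P ∣ Q —[ τᵃ ]→ P′ ∣ Q′
  Comʳ   : ∀ {P P′ Q Q′ x y} → P —[ outᵃ x y ]→ P′ → Q —[ inᵃ x y ]→ Q′ →
           P ∣ Q —[ τᵃ ]→ P′ ∣ Q′
  Closeˡ : ∀ {P P′ Q Q′ x y} → P —[ inᵃ x (var y) ]→ P′ → Q —[ boutᵃ x y ]→ Q′ →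
           var y ∉ fn P → P ∣ Q —[ τᵃ ]→ ν y (P′ ∣ Q′)
  Closeʳ : ∀ {P P′ Q Q′ x y} → P —[ boutᵃ x y ]→ P′ → Q —[ inᵃ x (var y) ]→ Q′ →
           var y ∉ fn Q → P ∣ Q —[ τᵃ ]→ ν y (P′ ∣ Q′)
  Rep    : ∀ {P P′ μ} → P ∣ ! P —[ μ ]→ P′ → ! P —[ μ ]→ P′
  Cong   : ∀ {P P′ Q Q′ μ} → P′ ≅ P → P —[ μ ]→ Q → Q ≅ Q′ → P′ —[ μ ]→ Q′

------------------------------------------------------------------------
-- Networks

-- A network with components P₀ , … , Pₘ.
record Network (m : ℕ) : Set where
  field
    restricted : List Var
    components : Vec Proc (suc m)

  component : Fin (suc m) → Proc
  component = lookup components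

  body : Proc
  body = foldl₁ _∣_ components

  componentBound : List Var
  componentBound = concat (map bound (toList components))

  -- Bound-names convention.
  field
    bound-distinct : Unique (restricted ++ componentBound)
    bound-not-free : ∀ {x} → x ∈ componentBound → var x ∉ fn body

  process : Proc
  process = List.foldr ν body restricted

open Network public using (restricted; component; process)

-- The position of component i in ((P₀ ∣ P₁) ∣ ⋯) ∣ Pₘ.

data Side : Set where
  left right : Side

position : ∀ m → Fin (suc m) → List Side
position m zero    = replicate m left
position m (suc j) = replicate (m ∸ suc (toℕ j)) left ++ right ∷ []

-- The action of the node that a proof tree contains for the parallel
-- component at the given position of its source.  Positions skip
-- restrictions, so they are stable under _≅_; occurrences of equal
-- components are kept apart.  Whether a bound name sent by a component
-- is restricted inside it or around it depends on the uses of Cong, so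
-- the action is determined up to free versus bound output; this does not
-- affect the output of an identifier.

contribution : ∀ {P μ Q} → P —[ μ ]→ Q → List Side → Maybe Action
contribution {μ = μ} _         []          = just μ
contribution (Open d _)        (s ∷ p)     = contribution d (s ∷ p)
contribution (Res d _)         (s ∷ p)     = contribution d (s ∷ p)
contribution (Cong _ d _)      (s ∷ p)     = contribution d (s ∷ p)
contribution (Parˡ d _)        (left ∷ p)  = contribution d p
contribution (Parˡ d _)        (right ∷ p) = nothing
contribution (Parʳ d _)        (left ∷ p)  = nothing
contribution (Parʳ d _)        (right ∷ p) = contribution d p
contribution (Comˡ d e)        (left ∷ p)  = contribution d p
contribution (Comˡ d e)        (right ∷ p) = contribution e p
contribution (Comʳ d e)        (left ∷ p)  = contribution d p
contribution (Comʳ d e)        (right ∷ p) = contribution e p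
contribution (Closeˡ d e _)    (left ∷ p)  = contribution d p
contribution (Closeˡ d e _)    (right ∷ p) = contribution e p
contribution (Closeʳ d e _)    (left ∷ p)  = contribution d p
contribution (Closeʳ d e _)    (right ∷ p) = contribution e p
contribution (I-Sum _ _ _)     (_ ∷ _)     = nothing
contribution (O-Sum _ _)       (_ ∷ _)     = nothing
contribution (τ-Sum _ _)       (_ ∷ _)     = nothing
contribution (Rep _)           (_ ∷ _)     = nothing

------------------------------------------------------------------------
-- Computations

record Step {m} (N N′ : Network m) : Set where
  constructor step
  field
    {label} : Action
    tree    : process N —[ label ]→ process N′

open Step public

record Infinite {m} (N : Network m) : Set where
  field
    state : ℕ → Network m
    first : Step N (state 0)
    rest  : ∀ n → Step (state n) (state (suc n))

open Infinite public

data Computation {m} (N : Network m) : Set where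
  finite   : ∀ {N′} → Star Step N N′ → Computation N
  infinite : Infinite N → Computation N

prepend : ∀ {m} {N N′ : Network m} → Step N N′ → Infinite N′ → Infinite N
prepend {N′ = N′} s I .state zero    = N′
prepend           s I .state (suc n) = state I n
prepend           s I .first         = s
prepend           s I .rest zero     = first I
prepend           s I .rest (suc n)  = rest I n

cons : ∀ {m} {N N′ : Network m} → Step N N′ → Computation N′ → Computation N
cons s (finite c)   = finite (s ◅ c)
cons s (infinite I) = infinite (prepend s I)

_followedBy_ : ∀ {m} {N N′ : Network m} → Star Step N N′ → Computation N′ → Computation N
ε       followedBy D = D
(s ◅ c) followedBy D = cons s (c followedBy D)

data _Extends_ {m} {N : Network m} : Computation N → Computation N → Set where
  itself : ∀ {C} → C Extends C
  longer : ∀ {N′} (c : Star Step N N′) (D : Computation N′) →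
           (c followedBy D) Extends finite c

-- The n-th entry is the observation of the n-th transition; it is `nothing`
-- after the end of a finite computation.
observe : ∀ {m} {N : Network m} → (∀ {M M′ : Network m} → Step M M′ → Maybe Action) →
          Computation N → ℕ → Maybe Action
observe f (finite ε)       _       = nothing
observe f (finite (s ◅ c)) zero    = f s
observe f (finite (s ◅ c)) (suc n) = observe f (finite c) n
observe f (infinite I)     zero    = f (first I)
observe f (infinite I)     (suc n) = f (rest I n)

labels : ∀ {m} {N : Network m} → Computation N → ℕ → Maybe Action
labels = observe (λ s → just (label s))

-- `nothing` stands for the transitions to which component i does not
-- contribute.
Proj : ∀ {m} {N : Network m} → Computation N → Fin (suc m) → ℕ → Maybe Action
Proj {m} C i = observe (λ s → contribution (tree s) (position m i)) C

-- `out` is not used by the components to communicate with each other: they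
-- communicate precisely when two of them contribute to the same transition.
OutIsExternal : ∀ {m} → Network m → Set
OutIsExternal P = ∀ (C : Computation P) n {i j μ μ′} → i ≢ j →
                  Proj C i n ≡ just μ → Proj C j n ≡ just μ′ → subject μ ≢ just out

------------------------------------------------------------------------
-- Electoral systems

ElectoralSystem : ∀ {m} → Network m → Set
ElectoralSystem {m} P =
  ∀ (C : Computation P) →
  Σ[ C′ ∈ Computation P ] C′ Extends C × Σ[ n ∈ Fin (suc m) ]
    (∀ i → ∃! _≡_ λ l → Proj C′ i l ≡ just (outᵃ out (ident (toℕ n)))) ×
    (∀ C″ → C″ Extends C′ → ∀ l y → y ≢ ident (toℕ n) → labels C″ l ≢ just (outᵃ out y))

------------------------------------------------------------------------
-- Hypergraphs

-- Node set {0, …, k-1}; the edges are the names in the list `edges`, read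
-- as a set, and only the values of `t` on them matter.
record Hypergraph (k : ℕ) : Set where
  field
    edges : List Name
    t     : Name → Subset k

open Hypergraph public

record SameHypergraph {k} (G G′ : Hypergraph k) : Set where
  field
    same-edges : ∀ x → x ∈ edges G ⇔ x ∈ edges G′
    same-types : ∀ {x} → x ∈ edges G → t G x ≡ t G′ x

-- Only the values of σX and σX⁻¹ on edges matter.
record Automorphism {k} (G : Hypergraph k) : Set where
  field
    σN       : Permutation′ k
    σX σX⁻¹  : Name → Name
    σX-edge  : ∀ {x} → x ∈ edges G → σX x ∈ edges G
    σX⁻¹-edge : ∀ {x} → x ∈ edges G → σX⁻¹ x ∈ edges G
    inverseˡ : ∀ {x} → x ∈ edges G → σX⁻¹ (σX x) ≡ x
    inverseʳ : ∀ {x} → x ∈ edges G → σX (σX⁻¹ x) ≡ x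
    -- t (σX x) = σN (t x)
    types    : ∀ {x} → x ∈ edges G → ∀ j →
               j ∈ˢ t G (σX x) ⇔ (∃[ i ] (i ∈ˢ t G x × σN ⟨$⟩ʳ i ≡ j))

open Automorphism public

hypergraph : ∀ {m} → Network m → Hypergraph (suc m)
hypergraph P .edges = filter (λ x → ¬? (x ≟ out)) (fn (Network.body P))
hypergraph P .t x   = tabulate λ n → does (x ∈? fn (component P n))

record AutomorphismOn {m} (P : Network m) : Set where
  field
    automorphism : Automorphism (hypergraph P)
    identifiers-agree : ∀ (n : Fin (suc m)) → ident (toℕ n) ∈ edges (hypergraph P) →
      σX automorphism (ident (toℕ n)) ≡ ident (toℕ (σN automorphism ⟨$⟩ʳ n))
    restricted-agree : ∀ {x} → x ∈ edges (hypergraph P) →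
      (x ∈ map var (restricted P)) ⇔ (σX automorphism x ∈ map var (restricted P))

open AutomorphismOn public

-- σ as a function on names: σN on the identifiers of nodes, σX on the
-- edges, the identity elsewhere.

module _ {m} {P : Network m} (σ : AutomorphismOn P) where

  onEdges : Name → Name
  onEdges x = if does (x ∈? edges (hypergraph P)) then σX (automorphism σ) x else x

  rename : Name → Name
  rename (ident n) with n <? suc m
  ... | yes n<k = ident (toℕ (σN (automorphism σ) ⟨$⟩ʳ fromℕ< n<k))
  ... | no _    = onEdges (ident n)
  rename x = onEdges x

  -- `ren` renames the bound names to fresh ones, which σ leaves unchanged;
  -- σ maps X to itself, so capture is avoided.
  apply : Proc → Proc
  apply Q = ren (edges (hypergraph P) ++ fn Q) rename Q

  SymmetricWrt : Set
  SymmetricWrt = ∀ i → component P (σN (automorphism σ) ⟨$⟩ʳ i) ≡α apply (component P i)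

Symmetric : ∀ {m} → Network m → Set
Symmetric P = ∀ (σ : AutomorphismOn P) → SymmetricWrt σ

-- The components of an electoral system contain identifiers free: otherwise
-- an identifier could be announced only after being received, and renaming it
-- along the computation would give one that announces an arbitrary name.
-- Hence identifiers are edges of its hypergraph, and a hypergraph G of
-- channels is compared with it modulo these edges: the other edges are exactly
-- those of G, and the identifiers put no constraint on the automorphisms, that
-- is, each automorphism of G extends to one on the network.

withoutIdentifiers : ∀ {k} → Hypergraph k → Hypergraph k
withoutIdentifiers {k} G .edges = filter (_∉? map (ident ∘ toℕ) (allFin k)) (edges G)
withoutIdentifiers     G .t     = t G

record HasHypergraph {m} (P : Network m) (G : Hypergraph (suc m)) : Set where
  field
    same   : SameHypergraph (withoutIdentifiers (hypergraph P)) G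
    extend : ∀ (ρ : Automorphism G) → Σ[ σ ∈ AutomorphismOn P ]
               (∀ i → σN (automorphism σ) ⟨$⟩ʳ i ≡ σN ρ ⟨$⟩ʳ i) ×
               (∀ {x} → x ∈ edges G → σX (automorphism σ) x ≡ σX ρ x)

module _ (x : Fin 4 → Var) where

  side : Fin 4 → Subset 4
  side 0F = ⁅ 0F ⁆ ∪ ⁅ 1F ⁆
  side 1F = ⁅ 1F ⁆ ∪ ⁅ 2F ⁆
  side 2F = ⁅ 2F ⁆ ∪ ⁅ 3F ⁆
  side 3F = ⁅ 3F ⁆ ∪ ⁅ 0F ⁆

  typeAmong : List (Fin 4) → Name → Subset 4
  typeAmong []       y = ⊥
  typeAmong (i ∷ is) y = if does (y ≟ var (x i)) then side i else typeAmong is y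

  square : Hypergraph 4
  square .edges = map (var ∘ x) (allFin 4)
  square .t     = typeAmong (allFin 4)

{-# OPTIONS --safe #-}
-- Each node starts with a mixed choice that treats its two channels alike.  The
-- sender of the first synchronisation passes its other channel along and then
-- waits for the result, while the receiver becomes a root.  Whichever way the two
-- pairs are formed, both roots end up knowing both channels between the pairs, so
-- they can synchronise even when they sit at opposite corners: this is how
-- mobility breaks the half-turn symmetry of the square, which no protocol that
-- keeps to the edges can do.  A losing root sends two messages.  Hence, up to the
-- election, each node sends at most one message more than it receives, while the
-- balance over all nodes is zero, so a node that has received three messages and
-- sent none knows that the three others have lost, and it elects itself.
--
-- That every maximal run of the protocol is finite and ends with an agreement is
-- found by exhaustive search on abstract behaviours.  Processes are interpreted by
-- such behaviours: the interpretation is invariant under structural congruence,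
-- every transition with its proof tree is matched by an abstract move, and a
-- process is determined by its interpretation up to structural congruence, which
-- allows an abstract run to be followed by networks that satisfy the bound-names
-- convention.
module Submission where

open import Defs
open import Data.Bool using (if_then_else_)
open import Data.Empty using (⊥)
open import Data.Fin using (Fin; zero; suc; toℕ; fromℕ<; opposite)
open import Data.Fin.Patterns using (0F; 1F; 2F; 3F)
open import Data.Fin.Permutation using (Permutation; _⟨$⟩ʳ_; _⟨$⟩ˡ_; _∘ₚ_; flip)
import Data.Fin.Permutation as Perm
import Data.Fin.Properties as Fin
open import Data.Fin.Subset using () renaming (_∈_ to _∈ˢ_)
open import Data.List using (List; []; _∷_; _++_; allFin; concat; length; map; tabulate; upTo)
import Data.List as List
import Data.List.Properties as List
open import Data.List.Membership.Propositional using (_∈_; _∉_)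
open import Data.List.Membership.Propositional.Properties hiding (finite)
open import Data.List.Relation.Binary.Permutation.Propositional
  using (_↭_; prep; ↭-refl; ↭-sym; ↭-trans; ↭⇒↭ₛ)
open import Data.List.Relation.Binary.Permutation.Propositional.Properties using (All-resp-↭; shift)
import Data.List.Relation.Binary.Permutation.Setoid.Properties as PermutationSetoid
open import Data.List.Relation.Binary.Pointwise using (Pointwise; []; _∷_; Pointwise-length; lookup⁺)
open import Data.List.Relation.Unary.All using (All; []; _∷_)
import Data.List.Relation.Unary.All as All
import Data.List.Relation.Unary.All.Properties as All
open import Data.List.Relation.Unary.AllPairs using ([]; _∷_)
import Data.List.Relation.Unary.AllPairs.Properties as AllPairs
open import Data.List.Relation.Unary.Any using (here; there; index)
open import Data.List.Relation.Unary.Any.Properties using (lookup-index)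
open import Data.List.Relation.Unary.Unique.Propositional using (Unique)
import Data.List.Relation.Unary.Unique.Propositional.Properties as Unique
open import Data.Maybe using (Maybe; just; nothing; _>>=_; _<∣>_; from-just)
open import Data.Nat using (ℕ; zero; suc; _+_; _*_; _≤_; _<_; _<?_; z≤n; s≤s)
import Data.Nat.Properties as ℕ
open import Data.Product using (Σ-syntax; ∃; ∃-syntax; ∃!; _×_; _,_; proj₁; proj₂)
open import Data.Sum using (_⊎_; inj₁; inj₂)
open import Data.Unit using (⊤; tt)
open import Data.Vec using (Vec; []; _∷_; lookup; _[_]≔_)
import Data.Vec as Vec
open import Data.Vec.Properties using
  (lookup∘tabulate; lookup∘update; lookup∘update′; tabulate∘lookup; tabulate-cong; []=⇒lookup; lookup⇒[]=)
open import Function using (_∘_; id)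
open import Function.Bundles using (_⇔_; mk⇔; Equivalence)
open import Function.Definitions using (Injective)
open import Relation.Binary.Construct.Closure.ReflexiveTransitive using (Star; ε; _◅_; _◅◅_)
open import Relation.Binary.PropositionalEquality
  using (_≡_; _≢_; refl; sym; trans; cong; subst; subst₂; setoid)
open import Relation.Nullary using (¬_; Dec; yes; no; does; ¬?; contradiction)
open import Relation.Nullary.Decidable using (dec-true; dec-false; does-⇔; _⊎-dec_)

-- Behaviours and their communications

-- `nm` is used for the free names of a network, `ch` for its restricted channels.
data Val : Set where
  nm : Name → Val
  ch : ℕ → Val

data Beh : Set
data Branch : Set

-- `done n` is inactive, and remembers that n was announced.
data Beh where
  choice : List Branch → Beh
  done   : ℕ → Beh

data Branch where
  recv : Val → (Val → Beh) → Branch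
  send : Val → Val → Beh → Branch

branches : Beh → List Branch
branches (choice bs) = bs
branches (done _)    = []

data Offer : Set where
  get put : Val → Val → Offer

infix 3 _⇑[_]_ _⟹_

data _⇑[_]_ (B : Beh) : Offer → Beh → Set where
  get : ∀ {c k} v → recv c k ∈ branches B → B ⇑[ get c v ] k v
  put : ∀ {c v C} → send c v C ∈ branches B → B ⇑[ put c v ] C

data _⟹_ {m} (Bs : Vec Beh m) : Vec Beh m → Set where
  comm     : ∀ {i j c v B C} → i ≢ j →
             lookup Bs i ⇑[ get c v ] B → lookup Bs j ⇑[ put c v ] C →
             Bs ⟹ Bs [ i ]≔ B [ j ]≔ C
  announce : ∀ {i n} → lookup Bs i ⇑[ put (nm out) (nm (ident n)) ] done n →
             Bs ⟹ Bs [ i ]≔ done n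

-- The invariant that confines communication to restricted channels and leaves only the announcement
-- of an identifier, ending in the matching `done`, visible outside. Every label of a network is
-- then `τᵃ` or an announcement.
data Safe : Branch → Set where
  recv     : ∀ {k B} → Safe (recv (ch k) B)
  send     : ∀ {k v B} → Safe (send (ch k) v B)
  announce : ∀ {n} → Safe (send (nm out) (nm (ident n)) (done n))

Final : ∀ {m} → Vec Beh m → Set
Final {m} Bs = Σ[ n ∈ Fin m ] ∀ i → lookup Bs i ≡ done (toℕ n)

Working : Beh → Set
Working B = ∀ n → B ≢ done n

-- Inductive, so that a proof also witnesses termination: its third field makes every successor
-- smaller. The second field keeps both partners of a communication working, hence `done` is entered
-- by announcements only.
data Good {m} (Bs : Vec Beh m) : Set where
  good : (∀ i → All Safe (branches (lookup Bs i))) →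
         (∀ {i j c v B C} → i ≢ j → lookup Bs i ⇑[ get c v ] B → lookup Bs j ⇑[ put c v ] C →
          Working B × Working C) →
         (∀ {Cs} → Bs ⟹ Cs → Good Cs) →
         Final Bs ⊎ ∃ (Bs ⟹_) →
         Good Bs

-- Exhaustive search over the runs of a vector of behaviours

everywhere : ∀ {m} {P : Fin m → Set} → (∀ i → Maybe (P i)) → Maybe (∀ i → P i)
everywhere {zero}  f = just λ ()
everywhere {suc m} f = do
  p ← f zero
  q ← everywhere (f ∘ suc)
  just λ { zero → p ; (suc i) → q i }

somewhere : ∀ {m} {A : Set} → (Fin m → Maybe A) → Maybe A
somewhere {zero}  f = nothing
somewhere {suc m} f = f zero <∣> somewhere (f ∘ suc)

allOf : ∀ {A : Set} {P : A → Set} → (∀ x → Maybe (P x)) → ∀ xs → Maybe (All P xs)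
allOf f []       = just []
allOf f (x ∷ xs) = do
  p  ← f x
  ps ← allOf f xs
  just (p ∷ ps)

oneOf : ∀ {A B : Set} (xs : List A) → (∀ {x} → x ∈ xs → Maybe B) → Maybe B
oneOf []       f = nothing
oneOf (x ∷ xs) f = f (here refl) <∣> oneOf xs (f ∘ there)

safe? : ∀ b → Maybe (Safe b)
safe? (recv (ch _) _)                                = just recv
safe? (send (ch _) _ _)                              = just send
safe? (send (nm out) (nm (ident n)) (done m)) with n ℕ.≟ m
... | yes refl = just announce
... | no _     = nothing
safe? _                                              = nothing

working? : ∀ B → Maybe (Working B)
working? (choice _) = just λ _ ()
working? (done _)   = nothing

done? : ∀ n B → Maybe (B ≡ done n)
done? n (done m) with m ℕ.≟ n
... | yes refl = just refl
... | no _     = nothing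
done? n _        = nothing

final? : ∀ {m} (Bs : Vec Beh m) → Maybe (Final Bs)
final? []                = nothing
final? {m} (done n ∷ Bs) with n <? m
... | no _    = nothing
... | yes n<m = do
  all ← everywhere λ i → done? (toℕ (fromℕ< n<m)) (lookup (done n ∷ Bs) i)
  just (fromℕ< n<m , all)
final? _                 = nothing

module _ {m : ℕ} (Bs : Vec Beh m) where

  -- What the search has to supply about one pair of branches. Pairs that cannot synchronise, or
  -- that `Safe` excludes, demand nothing, so a finite table over all pairs covers every
  -- communication.
  Sync : Fin m → Fin m → Branch → Branch → Set
  Sync i j (recv (ch k) B) (send (ch l) v C) = 
    k ≡ l → (Working (B v) × Working C) × Good (Bs [ i ]≔ B v [ j ]≔ C)
  Sync i j _               _                 = ⊤

  Announced : Fin m → Branch → Set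
  Announced i (send (nm out) (nm (ident n)) (done m)) = Good (Bs [ i ]≔ done m)
  Announced i _                                       = ⊤

  sync? : (∀ Cs → Maybe (Good Cs)) → ∀ i j b c → Maybe (Sync i j b c)
  sync? check i j (recv (ch k) B) (send (ch l) v C) with k ℕ.≟ l
  ... | no k≢l = just λ k≡l → contradiction k≡l k≢l
  ... | yes _  = do
    b ← working? (B v)
    c ← working? C
    g ← check (Bs [ i ]≔ B v [ j ]≔ C)
    just λ _ → (b , c) , g
  sync? check i j (recv (ch _) _) (send (nm _) _ _) = just tt
  sync? check i j (recv (ch _) _) (recv _ _)        = just tt
  sync? check i j (recv (nm _) _) _                 = just tt
  sync? check i j (send _ _ _)    _                 = just tt

  announced? : (∀ Cs → Maybe (Good Cs)) → ∀ i b → Maybe (Announced i b)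
  announced? check i (send (nm out) (nm (ident n)) (done m))   = check (Bs [ i ]≔ done m)
  announced? check i (recv _ _)                                = just tt
  announced? check i (send (ch _) _ _)                         = just tt
  announced? check i (send (nm (ident _)) _ _)                 = just tt
  announced? check i (send (nm (var _)) _ _)                   = just tt
  announced? check i (send (nm out) (ch _) _)                  = just tt
  announced? check i (send (nm out) (nm out) _)                = just tt
  announced? check i (send (nm out) (nm (var _)) _)            = just tt
  announced? check i (send (nm out) (nm (ident _)) (choice _)) = just tt

  step? : Maybe (∃ (Bs ⟹_))
  step? = somewhere λ i → oneOf (branches (lookup Bs i)) λ {b} b∈ →
          announce? i b b∈ <∣> somewhere λ j → oneOf (branches (lookup Bs j)) (comm? i j b∈)
    where
    announce? : ∀ i b → b ∈ branches (lookup Bs i) → Maybe (∃ (Bs ⟹_))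
    announce? i (send (nm out) (nm (ident n)) (done m)) b∈ with n ℕ.≟ m
    ... | yes refl = just (_ , announce (put b∈))
    ... | no _     = nothing
    announce? i _                                       _  = nothing
    comm? : ∀ i j {b c} → b ∈ branches (lookup Bs i) → c ∈ branches (lookup Bs j) →
            Maybe (∃ (Bs ⟹_))
    comm? i j {recv (ch k) B} {send (ch l) v C} b∈ c∈ with i Fin.≟ j | k ℕ.≟ l
    ... | no i≢j | yes refl = just (_ , comm i≢j (get v b∈) (put c∈))
    ... | _      | _        = nothing
    comm? i j _ _ = nothing

  module _ (safe : ∀ i → All Safe (branches (lookup Bs i)))
           (syn : ∀ i j → i ≢ j → All (λ b → All (Sync i j b) (branches (lookup Bs j)))
                                      (branches (lookup Bs i))) where

    synced : ∀ {i j c v B C} → i ≢ j → lookup Bs i ⇑[ get c v ] B → lookup Bs j ⇑[ put c v ] C →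
             (Working B × Working C) × Good (Bs [ i ]≔ B [ j ]≔ C)
    -- `Safe` forces the channel to be of the form `ch _`, where `Sync` unfolds to its informative
    -- clause.
    synced {i} {j} {c} i≢j (get v b∈) (put c∈)
      with c | All.lookup (safe i) b∈ | All.lookup (All.lookup (syn i j i≢j) b∈) c∈
    ... | ch _ | recv | g = g refl

    next : (∀ i → All (Announced i) (branches (lookup Bs i))) → ∀ {Cs} → Bs ⟹ Cs → Good Cs
    next ann (announce {i} (put b∈)) = All.lookup (ann i) b∈
    next ann (comm i≢j o o′)         = proj₂ (synced i≢j o o′)

-- The number is fuel: it makes the recursion structural, and running out of it gives `nothing`,
-- never a wrong answer.
check : ∀ {m} → ℕ → (Bs : Vec Beh m) → Maybe (Good Bs)
check zero    Bs = nothing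
check (suc f) Bs = do
  safe ← everywhere λ i → allOf safe? (branches (lookup Bs i))
  end  ← ((final? Bs >>= λ p → just (inj₁ p)) <∣> (step? Bs >>= λ p → just (inj₂ p)))
  ann  ← everywhere λ i → allOf (announced? Bs (check f) i) (branches (lookup Bs i))
  syn  ← everywhere λ i → everywhere λ j → apart i j
           (allOf (λ b → allOf (sync? Bs (check f) i j b) (branches (lookup Bs j)))
                  (branches (lookup Bs i)))
  just (good safe (λ i≢j o o′ → proj₁ (synced Bs safe syn i≢j o o′)) (next Bs safe syn ann) end)
  where
  apart : ∀ {m} {P : Set} (i j : Fin m) → Maybe P → Maybe (i ≢ j → P)
  apart i j p with i Fin.≟ j
  ... | yes i≡j = just λ i≢j → contradiction i≡j i≢j
  ... | no  _   = p >>= λ q → just λ _ → q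

-- Environments

if-same : ∀ {A : Set} x {v w : A} → (if does (var x ≟ var x) then v else w) ≡ v
if-same x {v} {w} = cong (if_then v else w) (dec-true (var x ≟ var x) refl)

if-other : ∀ {A : Set} {a x} {v w : A} → a ≢ var x → (if does (a ≟ var x) then v else w) ≡ w
if-other {a = a} {x} {v} {w} a≢x = cong (if_then v else w) (dec-false (a ≟ var x) a≢x)

Env : Set
Env = Name → Val

infixl 9 _[_≔_]

_[_≔_] : Env → Var → Val → Env
(ρ [ x ≔ v ]) a = if does (a ≟ var x) then v else ρ a

var-injective : ∀ {x y} → var x ≡ var y → x ≡ y
var-injective refl = refl

≔-same : ∀ ρ x v → (ρ [ x ≔ v ]) (var x) ≡ v
≔-same ρ x v = if-same x

≔-other : ∀ ρ {x a} v → a ≢ var x → (ρ [ x ≔ v ]) a ≡ ρ a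
≔-other ρ v = if-other

≔-cong : ∀ ρ σ {x v} a → (a ≢ var x → ρ a ≡ σ a) → (ρ [ x ≔ v ]) a ≡ (σ [ x ≔ v ]) a
≔-cong ρ σ {x} a h with a ≟ var x
... | yes _   = refl
... | no  a≢x = h a≢x

-- Free names

∈-∉⇒≢ : ∀ {a b : Name} {ns} → a ∈ ns → b ∉ ns → a ≢ b
∈-∉⇒≢ a∈ b∉ refl = b∉ a∈

∈-remove : ∀ {a x ns} → a ∈ ns → a ≢ var x → a ∈ remove x ns
∈-remove {x = x} = ∈-filter⁺ (λ y → ¬? (y ≟ var x))

∈-remove⁻ : ∀ {a x} ns → a ∈ remove x ns → a ∈ ns × a ≢ var x
∈-remove⁻ {x = x} ns = ∈-filter⁻ (λ y → ¬? (y ≟ var x)) {xs = ns}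

∈-∑⁺ : ∀ {n} (α : Fin n → Prefix) (P : Fin n → Proc) {a} i →
       a ∈ fnPrefixed (α i) (fn (P i)) → a ∈ fn (∑ α P)
∈-∑⁺ α P i a∈ = ∈-concat⁺′ a∈ (∈-tabulate⁺ i)

∈-∑⁻ : ∀ {n} (α : Fin n → Prefix) (P : Fin n → Proc) {a} →
       a ∈ fn (∑ α P) → ∃[ i ] a ∈ fnPrefixed (α i) (fn (P i))
∈-∑⁻ α P a∈ with ∈-concat⁻′ (List.tabulate λ i → fnPrefixed (α i) (fn (P i))) a∈
... | _ , a∈ns , ns∈ with ∈-tabulate⁻ ns∈
... | i , refl = i , a∈ns

∈-fn₄ : ∀ (P : Fin 4 → Proc) {a} → a ∈ fn (P 0F ∣ P 1F ∣ P 2F ∣ P 3F) → ∃[ i ] a ∈ fn (P i)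
∈-fn₄ P a∈ with ∈-++⁻ (fn (P 0F ∣ P 1F ∣ P 2F)) a∈
... | inj₂ a∈₃ = 3F , a∈₃
... | inj₁ a∈′ with ∈-++⁻ (fn (P 0F ∣ P 1F)) a∈′
...   | inj₂ a∈₂ = 2F , a∈₂
...   | inj₁ a∈″ with ∈-++⁻ (fn (P 0F)) a∈″
...     | inj₂ a∈₁ = 1F , a∈₁
...     | inj₁ a∈₀ = 0F , a∈₀

fresh-bound : ∀ {x} ns → var x ∈ ns → x < fresh ns
fresh-bound (_ ∷ ns)       (here refl) = ℕ.m≤m⊔n _ (fresh ns)
fresh-bound (var _ ∷ ns)   (there x∈)  = ℕ.≤-trans (fresh-bound ns x∈) (ℕ.m≤n⊔m _ (fresh ns))
fresh-bound (ident _ ∷ ns) (there x∈)  = fresh-bound ns x∈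
fresh-bound (out ∷ ns)     (there x∈)  = fresh-bound ns x∈

fresh-∉ : ∀ ns → var (fresh ns) ∉ ns
fresh-∉ ns x∈ = ℕ.<-irrefl refl (fresh-bound ns x∈)

-- Interpretation

-- In `Sem ρ P L Bs`, L lists the values of the unguarded restrictions of P from the
-- outside inwards and Bs the behaviours of its components from right to left.
-- Structural congruence moves restrictions into and out of left operands only, so
-- those on the right can be excluded, and L is not even permuted.
data Sem (ρ : Env) : Proc → List ℕ → ∀ {m} → Vec Beh (suc m) → Set
data SemPrefixed (ρ : Env) : Prefix → Proc → Branch → Set

data Sem ρ where
  sum : ∀ {n} {α : Fin n → Prefix} {P : Fin n → Proc} {B} (π : Permutation n (length (branches B))) →
        (∀ i → SemPrefixed ρ (α i) (P i) (List.lookup (branches B) (π ⟨$⟩ʳ i))) →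
        Sem ρ (∑ α P) [] (B ∷ [])
  res : ∀ {x P k L m} {Bs : Vec Beh (suc m)} → Sem (ρ [ x ≔ ch k ]) P L Bs → Sem ρ (ν x P) (k ∷ L) Bs
  par : ∀ {P Q L m} {B} {Bs : Vec Beh (suc m)} → Sem ρ P L Bs → Sem ρ Q [] (B ∷ []) →
        Sem ρ (P ∣ Q) L (B ∷ Bs)

-- The continuation of an input is interpreted at every value, including channels that occur nowhere
-- else; two continuations are later compared at such a channel. Silent prefixes have no clause, so
-- processes containing them have no interpretation.
data SemPrefixed ρ where
  recv : ∀ {a x P c B} → ρ a ≡ c → (∀ v → Sem (ρ [ x ≔ v ]) P [] (B v ∷ [])) →
         SemPrefixed ρ (a ⟨ x ⟩ⁱ) P (recv c B)
  send : ∀ {a b P c v B} → ρ a ≡ c → ρ b ≡ v → Sem ρ P [] (B ∷ []) →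
         SemPrefixed ρ (a ⟨ b ⟩ᵒ) P (send c v B)

Sem-ext : ∀ {ρ σ P L m} {Bs : Vec Beh (suc m)} → (∀ {a} → a ∈ fn P → ρ a ≡ σ a) →
          Sem ρ P L Bs → Sem σ P L Bs
SemPrefixed-ext : ∀ {ρ σ α P b} → (∀ {a} → a ∈ fnPrefixed α (fn P) → ρ a ≡ σ a) →
                  SemPrefixed ρ α P b → SemPrefixed σ α P b

Sem-ext h (sum {α = α} {P} π s) = sum π λ i → SemPrefixed-ext (λ a∈ → h (∈-∑⁺ α P i a∈)) (s i)
Sem-ext {ρ} {σ} h (res s) =
  res (Sem-ext (λ {a} a∈ → ≔-cong ρ σ a λ a≢x → h (∈-remove a∈ a≢x)) s)
Sem-ext h (par {P = P} s t) = par (Sem-ext (h ∘ ∈-++⁺ˡ) s) (Sem-ext (h ∘ ∈-++⁺ʳ (fn P)) t)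

SemPrefixed-ext {ρ} {σ} h (recv refl s) =
  recv (sym (h (here refl)))
       λ v → Sem-ext (λ {a} a∈ → ≔-cong ρ σ a λ a≢x → h (there (∈-remove a∈ a≢x))) (s v)
SemPrefixed-ext h (send refl refl s) =
  send (sym (h (here refl))) (sym (h (there (here refl)))) (Sem-ext (λ a∈ → h (there (there a∈))) s)

-- Renaming

under-image : ∀ f {av x a ns} → (∀ {a} → a ∈ remove x ns → f a ∈ av) → a ∈ ns →
              (f [ x ↦ var (fresh av) ]) a ∈ var (fresh av) ∷ av
under-image f {x = x} {a} h a∈ with a ≟ var x
... | yes _   = here refl
... | no  a≢x = there (h (∈-remove a∈ a≢x))

-- The binder `x` may become any `y` to which no other free name is sent. This covers the fresh
-- names of `ren` as well as the numbered binders of `refresh`.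
under-env : ∀ (ρ σ : Env) f {x y v a ns} → (∀ {a} → a ∈ remove x ns → ρ (f a) ≡ σ a) →
            (∀ {a} → a ∈ remove x ns → f a ≢ var y) → a ∈ ns →
            (ρ [ y ≔ v ]) ((f [ x ↦ var y ]) a) ≡ (σ [ x ≔ v ]) a
under-env ρ σ f {x} {y} {v} {a} h avoid a∈ with a ≟ var x
... | yes _   = ≔-same ρ y v
... | no  a≢x = trans (≔-other ρ v (avoid (∈-remove a∈ a≢x))) (h (∈-remove a∈ a≢x))

-- The substitution lemma: renaming by `f` amounts to composing the environment with `f`. Since `av`
-- contains all images, the fresh binders capture none of them.
Sem-ren : ∀ {ρ σ av f P L m} {Bs : Vec Beh (suc m)} → (∀ {a} → a ∈ fn P → ρ (f a) ≡ σ a) →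
          (∀ {a} → a ∈ fn P → f a ∈ av) → Sem σ P L Bs → Sem ρ (ren av f P) L Bs
SemPrefixed-ren : ∀ {ρ σ av f α P b} → (∀ {a} → a ∈ fnPrefixed α (fn P) → ρ (f a) ≡ σ a) →
                  (∀ {a} → a ∈ fnPrefixed α (fn P) → f a ∈ av) → SemPrefixed σ α P b →
                  SemPrefixed ρ (renPrefix av f α)
                    (ren (proj₁ (underPrefix av f α)) (proj₂ (underPrefix av f α)) P) b

Sem-ren h g (sum {α = α} {P} π s) = sum π λ i →
  SemPrefixed-ren (λ a∈ → h (∈-∑⁺ α P i a∈)) (λ a∈ → g (∈-∑⁺ α P i a∈)) (s i)
Sem-ren {ρ} {σ} {av} {f} h g (res s) =
  res (Sem-ren (under-env ρ σ f h λ a∈ eq → fresh-∉ av (subst (_∈ av) eq (g a∈)))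
               (under-image f g) s)
Sem-ren h g (par {P = P} s t) =
  par (Sem-ren (h ∘ ∈-++⁺ˡ) (g ∘ ∈-++⁺ˡ) s)
      (Sem-ren (h ∘ ∈-++⁺ʳ (fn P)) (g ∘ ∈-++⁺ʳ (fn P)) t)

SemPrefixed-ren {ρ} {σ} {av} {f} h g (recv refl s) =
  recv (h (here refl))
       λ v → Sem-ren (under-env ρ σ f (h ∘ there) λ a∈ eq → fresh-∉ av (subst (_∈ av) eq (g (there a∈))))
                     (under-image f (g ∘ there)) (s v)
SemPrefixed-ren h g (send refl refl s) =
  send (h (here refl)) (h (there (here refl))) 
       (Sem-ren (λ a∈ → h (there (there a∈))) (λ a∈ → g (there (there a∈))) s)

Sem-[/] : ∀ {ρ P y x m} {Bs : Vec Beh (suc m)} → Sem (ρ [ x ≔ ρ y ]) P [] Bs → Sem ρ (P [ y / x ]) [] Bs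
Sem-[/] {ρ} {P} {y} {x} = Sem-ren (λ {a} _ → env a) (λ {a} → image a)
  where
  env : ∀ a → ρ ((id [ x ↦ y ]) a) ≡ (ρ [ x ≔ ρ y ]) a
  env a with a ≟ var x
  ... | yes _ = refl
  ... | no _  = refl
  image : ∀ a → a ∈ fn P → (id [ x ↦ y ]) a ∈ y ∷ fn P
  image a a∈ with a ≟ var x
  ... | yes _ = here refl
  ... | no _  = there a∈

-- Alpha-conversion and structural congruence

_⊢_~_ : Scope → Env → Env → Set
Γ ⊢ ρ ~ σ = ∀ {a b} → Γ ⊢ a ≈ₙ b → ρ a ≡ σ b

~-∷ : ∀ {Γ} ρ σ {x y v} → Γ ⊢ ρ ~ σ → ((x , y) ∷ Γ) ⊢ (ρ [ x ≔ v ]) ~ (σ [ y ≔ v ])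
~-∷ ρ σ {x} {y} {v} h here              = trans (≔-same ρ x v) (sym (≔-same σ y v))
~-∷ ρ σ {v = v}     h (there a≢x b≢y e) =
  trans (≔-other ρ v a≢x) (trans (h e) (sym (≔-other σ v b≢y)))

Sem-≈ : ∀ {Γ ρ σ P Q L m} {Bs : Vec Beh (suc m)} → Γ ⊢ P ≈ Q → Γ ⊢ ρ ~ σ → Sem ρ P L Bs → Sem σ Q L Bs
SemPrefixed-≈ : ∀ {Γ Δ ρ σ α β P Q b} → Γ ⊢ α ≈ₚ β ⊣ Δ → Δ ⊢ P ≈ Q → Γ ⊢ ρ ~ σ →
                SemPrefixed ρ α P b → SemPrefixed σ β Q b

Sem-≈ {σ = σ} (sum {β = β} {Q} π Δ p q) h (sum {B = B} θ s) = sum (flip π ∘ₚ θ) λ i →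
  subst (λ j → SemPrefixed σ (β j) (Q j) (List.lookup (branches B) (θ ⟨$⟩ʳ (π ⟨$⟩ˡ i))))
        (Perm.inverseʳ π) (SemPrefixed-≈ (p (π ⟨$⟩ˡ i)) (q (π ⟨$⟩ˡ i)) h (s (π ⟨$⟩ˡ i)))
Sem-≈ {ρ = ρ} {σ} (res e) h (res s) = res (Sem-≈ e (~-∷ ρ σ h) s)
Sem-≈ (par e f) h (par s t) = par (Sem-≈ e h s) (Sem-≈ f h t)

SemPrefixed-≈ {ρ = ρ} {σ} (input e) q h (recv refl s) =
  recv (sym (h e)) λ v → Sem-≈ q (~-∷ ρ σ h) (s v)
SemPrefixed-≈ (output e f) q h (send refl refl s) = send (sym (h e)) (sym (h f)) (Sem-≈ q h s)

swap* : Scope → Scope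
swap* = List.map λ (x , y) → y , x

≈ₙ-sym : ∀ {Γ a b} → Γ ⊢ a ≈ₙ b → swap* Γ ⊢ b ≈ₙ a
≈ₙ-sym free              = free
≈ₙ-sym here              = here
≈ₙ-sym (there a≢x b≢y e) = there b≢y a≢x (≈ₙ-sym e)

≈ₚ-sym : ∀ {Γ Δ α β} → Γ ⊢ α ≈ₚ β ⊣ Δ → swap* Γ ⊢ β ≈ₚ α ⊣ swap* Δ
≈ₚ-sym (input e)    = input (≈ₙ-sym e)
≈ₚ-sym (output e f) = output (≈ₙ-sym e) (≈ₙ-sym f)
≈ₚ-sym silent       = silent

≈-sym : ∀ {Γ P Q} → Γ ⊢ P ≈ Q → swap* Γ ⊢ Q ≈ P
≈-sym {Γ} (sum {α = α} {P} {β} {Q} π Δ p q) = sum (flip π) (λ i → swap* (Δ (π ⟨$⟩ˡ i)))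
  (λ i → subst (λ j → swap* Γ ⊢ β j ≈ₚ α (π ⟨$⟩ˡ i) ⊣ swap* (Δ (π ⟨$⟩ˡ i))) (Perm.inverseʳ π)
               (≈ₚ-sym (p (π ⟨$⟩ˡ i))))
  (λ i → subst (λ j → swap* (Δ (π ⟨$⟩ˡ i)) ⊢ Q j ≈ P (π ⟨$⟩ˡ i)) (Perm.inverseʳ π)
               (≈-sym (q (π ⟨$⟩ˡ i))))
≈-sym (res e)   = res (≈-sym e)
≈-sym (par e f) = par (≈-sym e) (≈-sym f)
≈-sym (rep e)   = rep (≈-sym e)

-- Proved together with its converse because `≅-sym` is a constructor. Extrusion keeps the list of
-- restrictions, as the right operand contributes none, and the extruded name is not free in that
-- operand.
Sem-≅  : ∀ {P Q} → P ≅ Q → ∀ {ρ L m} {Bs : Vec Beh (suc m)} → Sem ρ P L Bs → Sem ρ Q L Bs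
Sem-≅⁻ : ∀ {P Q} → P ≅ Q → ∀ {ρ L m} {Bs : Vec Beh (suc m)} → Sem ρ Q L Bs → Sem ρ P L Bs
SemPrefixed-cong : ∀ {ρ α P Q b} → (∀ {σ m} {Bs : Vec Beh (suc m)} → Sem σ P [] Bs → Sem σ Q [] Bs) →
                   SemPrefixed ρ α P b → SemPrefixed ρ α Q b

Sem-≅ (alpha e)     s                 = Sem-≈ e (λ { free → refl }) s
Sem-≅ (extrude x∉Q) {ρ} (par (res s) t)   =
  res (par s (Sem-ext (λ a∈ → sym (≔-other ρ _ (∈-∉⇒≢ a∈ x∉Q))) t))
Sem-≅ ≅-refl        s                 = s
Sem-≅ (≅-sym e)     s                 = Sem-≅⁻ e s
Sem-≅ (≅-trans e f) s                 = Sem-≅ f (Sem-≅ e s)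
Sem-≅ (∑-cong e)    (sum π s)         = sum π λ i → SemPrefixed-cong (Sem-≅ (e i)) (s i)
Sem-≅ (ν-cong e)    (res s)           = res (Sem-≅ e s)
Sem-≅ (∣-cong e f)  (par s t)         = par (Sem-≅ e s) (Sem-≅ f t)

Sem-≅⁻ (alpha e)     s                = Sem-≈ (≈-sym e) (λ { free → refl }) s
Sem-≅⁻ (extrude x∉Q) {ρ} (res (par s t))  =
  par (res s) (Sem-ext (λ a∈ → ≔-other ρ _ (∈-∉⇒≢ a∈ x∉Q)) t)
Sem-≅⁻ ≅-refl        s                = s
Sem-≅⁻ (≅-sym e)     s                = Sem-≅ e s
Sem-≅⁻ (≅-trans e f) s                = Sem-≅⁻ e (Sem-≅⁻ f s)
Sem-≅⁻ (∑-cong e)    (sum π s)        = sum π λ i → SemPrefixed-cong (Sem-≅⁻ (e i)) (s i)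
Sem-≅⁻ (ν-cong e)    (res s)          = res (Sem-≅⁻ e s)
Sem-≅⁻ (∣-cong e f)  (par s t)        = par (Sem-≅⁻ e s) (Sem-≅⁻ f t)

SemPrefixed-cong f (recv e s)    = recv e λ v → f (s v)
SemPrefixed-cong f (send e e′ s) = send e e′ (f s)

-- Transitions as moves of behaviours

infix 4 _≋_ _∼_

data _≋_ : Name → Val → Set where
  nm : ∀ {a} → a ≋ nm a
  ch : ∀ {x k} → var x ≋ ch k

-- Sending a restricted channel matches a free as well as a bound output: which of them a proof tree
-- shows depends on where the restriction stands.
data _∼_ : Action → Offer → Set where
  inᵃ   : ∀ {x y c v} → x ≋ c → y ≋ v → inᵃ x y ∼ get c v
  outᵃ  : ∀ {x y c v} → x ≋ c → y ≋ v → outᵃ x y ∼ put c v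
  boutᵃ : ∀ {x y c k} → x ≋ c → boutᵃ x y ∼ put c (ch k)

-- Only variables may denote channels, so `out` and the identifiers always denote themselves.
Faithful : Env → Set
Faithful ρ = ∀ a → a ≋ ρ a

Faithful-≔ : ∀ {ρ x k} → Faithful ρ → Faithful (ρ [ x ≔ ch k ])
Faithful-≔ {x = x} h a with a ≟ var x
... | yes refl = ch
... | no _     = h a

-- The component at the head of the vector is the rightmost one.
path : ∀ {m} → Fin (suc m) → List Side
path {zero}  zero    = []
path {suc m} zero    = right ∷ []
path {suc m} (suc i) = left ∷ path i

Contribution : Set
Contribution = List Side → Maybe Action

Acts : Contribution → List Side → Offer → Set
Acts f p ℓ = ∃[ μ ] f p ≡ just μ × μ ∼ ℓ

-- Contributions are read through an arbitrary `f`, so that the same record speaks of a proof tree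
-- and, with shifted paths, of its subtrees.
record Move (f : Contribution) {m} (Bs Cs : Vec Beh (suc m)) (ℓ : Offer) : Set where
  constructor move
  field
    {who}    : Fin (suc m)
    {after}  : Beh
    offer    : lookup Bs who ⇑[ ℓ ] after
    result   : Cs ≡ Bs [ who ]≔ after
    acts     : Acts f (path who) ℓ
    idle     : ∀ j → j ≢ who → f (path j) ≡ nothing

record Communication (f : Contribution) {m} (Bs Cs : Vec Beh (suc m)) : Set where
  constructor communication
  field
    {who₁ who₂}     : Fin (suc m)
    {channel value} : Val
    {after₁ after₂} : Beh
    distinct        : who₁ ≢ who₂
    offer₁          : lookup Bs who₁ ⇑[ get channel value ] after₁
    offer₂          : lookup Bs who₂ ⇑[ put channel value ] after₂
    result          : Cs ≡ Bs [ who₁ ]≔ after₁ [ who₂ ]≔ after₂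
    acts₁           : Acts f (path who₁) (get channel value)
    acts₂           : Acts f (path who₂) (put channel value)
    idle            : ∀ j → j ≢ who₁ → j ≢ who₂ → f (path j) ≡ nothing

module _ {f g : Contribution} (g≡f : ∀ p → g p ≡ f p) where

  Acts-cong : ∀ {p ℓ} → Acts f p ℓ → Acts g p ℓ
  Acts-cong {p} (μ , eq , μ∼) = μ , trans (g≡f p) eq , μ∼

  Move-cong : ∀ {m} {Bs Cs : Vec Beh (suc m)} {ℓ} → Move f Bs Cs ℓ → Move g Bs Cs ℓ
  Move-cong (move o r a i) = move o r (Acts-cong a) λ j j≢ → trans (g≡f _) (i j j≢)

  Communication-cong : ∀ {m} {Bs Cs : Vec Beh (suc m)} → Communication f Bs Cs → Communication g Bs Cs
  Communication-cong (communication d o₁ o₂ r a₁ a₂ i) =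
    communication d o₁ o₂ r (Acts-cong a₁) (Acts-cong a₂) λ j j≢ j≢′ → trans (g≡f _) (i j j≢ j≢′)

module _ {f g : Contribution} (g≡f : ∀ p → g (left ∷ p) ≡ f p) where

  Move-left : ∀ {m} {B} {Bs Cs : Vec Beh (suc m)} {ℓ} → g (right ∷ []) ≡ nothing →
              Move f Bs Cs ℓ → Move g (B ∷ Bs) (B ∷ Cs) ℓ
  Move-left none (move {who = i} o refl (μ , eq , μ∼) idle) =
    move {who = suc i} o refl (μ , trans (g≡f _) eq , μ∼)
      λ { zero _ → none ; (suc j) j≢ → trans (g≡f _) (idle j (j≢ ∘ cong suc)) }

  Communication-left : ∀ {m} {B} {Bs Cs : Vec Beh (suc m)} → g (right ∷ []) ≡ nothing →
                       Communication f Bs Cs → Communication g (B ∷ Bs) (B ∷ Cs)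
  Communication-left none (communication {who₁ = i} {j} d o₁ o₂ refl (μ , eq , μ∼) (μ′ , eq′ , μ∼′) idle) =
    communication {who₁ = suc i} {suc j} (d ∘ Fin.suc-injective) o₁ o₂ refl
      (μ , trans (g≡f _) eq , μ∼) (μ′ , trans (g≡f _) eq′ , μ∼′)
      λ { zero _ _ → none
        ; (suc k) k≢i k≢j → trans (g≡f _) (idle k (k≢i ∘ cong suc) (k≢j ∘ cong suc)) }

  module _ {h : Contribution} (g≡h : ∀ p → g (right ∷ p) ≡ h p) where

    Communication-getˡ : ∀ {m} {B C} {Bs Cs : Vec Beh (suc m)} {c v} →
                         Move f Bs Cs (get c v) → Move h (B ∷ []) (C ∷ []) (put c v) →
                         Communication g (B ∷ Bs) (C ∷ Cs)
    Communication-getˡ (move {who = i} o refl (μ , eq , μ∼) idle)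
                       (move {who = zero} o′ refl (μ′ , eq′ , μ∼′) _) =
      communication {who₁ = suc i} {zero} (λ ()) o o′ refl
        (μ , trans (g≡f _) eq , μ∼) (μ′ , trans (g≡h _) eq′ , μ∼′)
        λ { zero _ 0≢0 → contradiction refl 0≢0
          ; (suc j) j≢ _ → trans (g≡f _) (idle j (j≢ ∘ cong suc)) }

    Communication-putˡ : ∀ {m} {B C} {Bs Cs : Vec Beh (suc m)} {c v} →
                         Move f Bs Cs (put c v) → Move h (B ∷ []) (C ∷ []) (get c v) →
                         Communication g (B ∷ Bs) (C ∷ Cs)
    Communication-putˡ (move {who = i} o refl (μ , eq , μ∼) idle)
                       (move {who = zero} o′ refl (μ′ , eq′ , μ∼′) _) =
      communication {who₁ = zero} {suc i} (λ ()) o′ o refl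
        (μ′ , trans (g≡h _) eq′ , μ∼′) (μ , trans (g≡f _) eq , μ∼)
        λ { zero 0≢0 _ → contradiction refl 0≢0
          ; (suc j) _ j≢ → trans (g≡f _) (idle j (j≢ ∘ cong suc)) }

Move-right : ∀ {f g : Contribution} {m} {B C} {Bs : Vec Beh (suc m)} {ℓ} →
             (∀ p → g (right ∷ p) ≡ f p) → (∀ p → g (left ∷ p) ≡ nothing) →
             Move f (B ∷ []) (C ∷ []) ℓ → Move g (B ∷ Bs) (C ∷ Bs) ℓ
Move-right g≡f none (move {who = zero} o refl (μ , eq , μ∼) _) =
  move {who = zero} o refl (μ , trans (g≡f _) eq , μ∼)
    λ { zero 0≢0 → contradiction refl 0≢0 ; (suc j) _ → none _ }

Move-alone : ∀ {f : Contribution} {μ B C ℓ} → f [] ≡ just μ → μ ∼ ℓ → B ⇑[ ℓ ] C →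
             Move f (B ∷ []) (C ∷ []) ℓ
Move-alone eq μ∼ o =
  move {who = zero} o refl (_ , eq , μ∼) λ { zero 0≢0 → contradiction refl 0≢0 }

-- A bound output takes `k` out of the list of restrictions and hands it to the free name `y`;
-- closing puts it back in front, which is why silent steps keep the list only up to permutation. By
-- `x ≢ var y` the subject keeps its value when `y` is reassigned.
Outcome : Env → List ℕ → ∀ {m} → Vec Beh (suc m) → Contribution → Action → Proc → Set
Outcome ρ L Bs f (inᵃ x y) P =
  ∃[ Cs ] Move f Bs Cs (get (ρ x) (ρ y)) × Sem ρ P L Cs
Outcome ρ L Bs f (outᵃ x y) P =
  ∃[ Cs ] Move f Bs Cs (put (ρ x) (ρ y)) × Sem ρ P L Cs
Outcome ρ L Bs f (boutᵃ x y) P =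
  ∃[ Cs ] ∃[ L₁ ] ∃[ k ] ∃[ L₂ ] L ≡ L₁ ++ k ∷ L₂ × x ≢ var y ×
    Move f Bs Cs (put (ρ x) (ch k)) × Sem (ρ [ y ≔ ch k ]) P (L₁ ++ L₂) Cs
Outcome ρ L Bs f τᵃ P =
  ∃[ Cs ] ∃[ L′ ] L ↭ L′ × Communication f Bs Cs × Sem ρ P L′ Cs

Outcome-cong : ∀ {ρ L m} {Bs : Vec Beh (suc m)} {f g P Q} μ → (∀ p → g p ≡ f p) → P ≅ Q →
               Outcome ρ L Bs f μ P → Outcome ρ L Bs g μ Q
Outcome-cong (inᵃ _ _)   e P≅Q (_ , t , s) = _ , Move-cong e t , Sem-≅ P≅Q s
Outcome-cong (outᵃ _ _)  e P≅Q (_ , t , s) = _ , Move-cong e t , Sem-≅ P≅Q s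
Outcome-cong (boutᵃ _ _) e P≅Q (_ , _ , _ , _ , L≡ , x≢y , t , s) =
  _ , _ , _ , _ , L≡ , x≢y , Move-cong e t , Sem-≅ P≅Q s
Outcome-cong τᵃ          e P≅Q (_ , _ , L↭ , t , s) = _ , _ , L↭ , Communication-cong e t , Sem-≅ P≅Q s

getOffer : ∀ {ρ x z P b B} y → SemPrefixed ρ (x ⟨ z ⟩ⁱ) P b → b ∈ branches B →
           ∃[ C ] B ⇑[ get (ρ x) (ρ y) ] C × Sem ρ (P [ y / z ]) [] (C ∷ [])
getOffer {ρ} y (recv refl s) b∈ = _ , get (ρ y) b∈ , Sem-[/] (s (ρ y))

putOffer : ∀ {ρ x y P b B} → SemPrefixed ρ (x ⟨ y ⟩ᵒ) P b → b ∈ branches B →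
           ∃[ C ] B ⇑[ put (ρ x) (ρ y) ] C × Sem ρ P [] (C ∷ [])
putOffer (send refl refl s) b∈ = _ , put b∈ , s

contribution-Res : ∀ {P P′ μ y} (d : P —[ μ ]→ P′) (y∉ : var y ∉ names μ) p →
                   contribution (Res d y∉) p ≡ contribution d p
contribution-Res d y∉ []      = refl
contribution-Res d y∉ (_ ∷ _) = refl

contribution-Cong : ∀ {P P′ Q Q′ μ} (e : P ≅ Q) (d : Q —[ μ ]→ Q′) (e′ : Q′ ≅ P′) p →
                    contribution (Cong e d e′) p ≡ contribution d p
contribution-Cong e d e′ []      = refl
contribution-Cong e d e′ (_ ∷ _) = refl

-- With a single component the path is empty and the contribution is the new bound output; with
-- several it is the free output found in the subtree. `_∼_` accepts either.
Move-Open : ∀ {P P′ x y m} {Bs Cs : Vec Beh (suc m)} {c k} (d : P —[ outᵃ x (var y) ]→ P′)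
            (x≢y : x ≢ var y) → x ≋ c →
            Move (contribution d) Bs Cs (put c (ch k)) →
            Move (contribution (Open d x≢y)) Bs Cs (put c (ch k))
Move-Open {m = zero} d x≢y x≋ (move {who = zero} o r _ _) =
  move {who = zero} o r (_ , refl , boutᵃ x≋) λ { zero 0≢0 → contradiction refl 0≢0 }
Move-Open {m = suc m} d x≢y x≋ (move {who = i} o r (μ , eq , μ∼) idle) =
  move {who = i} o r (μ , trans (open-path i) eq , μ∼) λ j j≢ → trans (open-path j) (idle j j≢)
  where
  open-path : (j : Fin (suc (suc m))) → contribution (Open d x≢y) (path j) ≡ contribution d (path j)
  open-path zero    = refl
  open-path (suc j) = refl

≔-swap : ∀ (ρ : Env) {x y v w} → x ≢ y → ∀ a →
         (ρ [ x ≔ v ] [ y ≔ w ]) a ≡ (ρ [ y ≔ w ] [ x ≔ v ]) a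
≔-swap ρ {x} {y} {v} {w} x≢y a = compare (a ≟ var x)
  where
  compare : Dec (a ≡ var x) → (ρ [ x ≔ v ] [ y ≔ w ]) a ≡ (ρ [ y ≔ w ] [ x ≔ v ]) a
  compare (yes refl) = trans (≔-other (ρ [ x ≔ v ]) w (x≢y ∘ var-injective))
                             (trans (≔-same ρ x v) (sym (≔-same (ρ [ y ≔ w ]) x v)))
  compare (no a≢x)   = trans (≔-cong (ρ [ x ≔ v ]) ρ a λ _ → ≔-other ρ v a≢x)
                             (sym (≔-other (ρ [ y ≔ w ]) v a≢x))

module _ {ρ : Env} {y : Var} {k : ℕ} where

  Outcome-Res : ∀ {L m} {Bs : Vec Beh (suc m)} {f P} μ → var y ∉ names μ →
                Outcome (ρ [ y ≔ ch k ]) L Bs f μ P → Outcome ρ (k ∷ L) Bs f μ (ν y P)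
  Outcome-Res (inᵃ a b)  y∉ (_ , t , s) =
    _ , subst₂ (λ c v → Move _ _ _ (get c v)) (≔-other ρ _ λ e → y∉ (here (sym e)))
                                              (≔-other ρ _ λ e → y∉ (there (here (sym e)))) t , res s
  Outcome-Res (outᵃ a b) y∉ (_ , t , s) =
    _ , subst₂ (λ c v → Move _ _ _ (put c v)) (≔-other ρ _ λ e → y∉ (here (sym e)))
                                              (≔-other ρ _ λ e → y∉ (there (here (sym e)))) t , res s
  Outcome-Res (boutᵃ a x) y∉ (_ , _ , _ , _ , refl , a≢x , t , s) =
    _ , k ∷ _ , _ , _ , refl , a≢x ,
    subst (λ c → Move _ _ _ (put c _)) (≔-other ρ _ λ e → y∉ (here (sym e))) t ,
    res (Sem-ext (λ {a} _ → ≔-swap ρ (λ e → y∉ (there (here (cong var e)))) a) s)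
  Outcome-Res τᵃ y∉ (_ , _ , L↭ , t , s) = _ , _ , prep k L↭ , t , res s

[]≢++∷ : ∀ {A : Set} (xs : List A) {x ys} → [] ≢ xs ++ x ∷ ys
[]≢++∷ []      ()
[]≢++∷ (_ ∷ _) ()

-- Induction on the proof tree, which yields the contributions of all components along with the new
-- interpretation; `Cong` is handled by the invariance of `Sem`.
sound : ∀ {P μ P′ ρ L m} {Bs : Vec Beh (suc m)} (d : P —[ μ ]→ P′) → Faithful ρ → Sem ρ P L Bs →
        Outcome ρ L Bs (contribution d) μ P′
sound {ρ = ρ} (I-Sum {P = P} j y αj≡) F (sum {B = B} π s)
  with getOffer {B = B} y (subst (λ α → SemPrefixed ρ α (P j) _) αj≡ (s j)) (∈-lookup (π ⟨$⟩ʳ j))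
... | C , o , s′ = C ∷ [] , Move-alone refl (inᵃ (F _) (F _)) o , s′
sound {ρ = ρ} (O-Sum {P = P} j αj≡) F (sum {B = B} π s)
  with putOffer {B = B} (subst (λ α → SemPrefixed ρ α (P j) _) αj≡ (s j)) (∈-lookup (π ⟨$⟩ʳ j))
... | C , o , s′ = C ∷ [] , Move-alone refl (outᵃ (F _) (F _)) o , s′
sound {ρ = ρ} (τ-Sum {P = P} j αj≡) F (sum {B = B} π s)
  with subst (λ α → SemPrefixed ρ α (P j) _) αj≡ (s j)
... | ()
sound {ρ = ρ} (Open {x = x} {y} d x≢y) F (res {k = k} {L} s) with sound d (Faithful-≔ F) s
... | Cs , t , s′ =
  Cs , [] , k , L , refl , x≢y ,
  Move-Open d x≢y (F x)
    (subst₂ (λ c v → Move _ _ _ (put c v)) (≔-other ρ _ x≢y) (≔-same ρ y _) t) , s′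
sound (Res {μ = μ} d y∉) F (res s) =
  Outcome-cong μ (contribution-Res d y∉) ≅-refl (Outcome-Res μ y∉ (sound d (Faithful-≔ F) s))
sound (Parˡ {μ = inᵃ _ _} d _) F (par s t) with sound d F s
... | Cs , u , s′ = _ , Move-left (λ _ → refl) refl u , par s′ t
sound (Parˡ {μ = outᵃ _ _} d _) F (par s t) with sound d F s
... | Cs , u , s′ = _ , Move-left (λ _ → refl) refl u , par s′ t
sound {ρ = ρ} (Parˡ {Q = Q} {μ = boutᵃ x y} d #) F (par s t) with sound d F s
... | Cs , L₁ , k , L₂ , L≡ , x≢y , u , s′ =
  _ , L₁ , k , L₂ , L≡ , x≢y , Move-left (λ _ → refl) refl u ,
  par s′ (Sem-ext (λ a∈ → sym (≔-other ρ _ (∈-∉⇒≢ a∈ λ y∈ → # (here refl , y∈)))) t)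
sound (Parˡ {μ = τᵃ} d _) F (par s t) with sound d F s
... | Cs , L′ , L↭ , u , s′ = _ , L′ , L↭ , Communication-left (λ _ → refl) refl u , par s′ t
sound (Parʳ {μ = inᵃ _ _} d _) F (par s t) with sound d F t
... | _ ∷ [] , u , t′ = _ , Move-right (λ _ → refl) (λ _ → refl) u , par s t′
sound (Parʳ {μ = outᵃ _ _} d _) F (par s t) with sound d F t
... | _ ∷ [] , u , t′ = _ , Move-right (λ _ → refl) (λ _ → refl) u , par s t′
-- A right operand has no unguarded restriction that could be opened.
sound (Parʳ {μ = boutᵃ _ _} d _) F (par s t) with sound d F t
... | _ , L₁ , _ , _ , L≡ , _ = contradiction L≡ ([]≢++∷ L₁)
-- A right operand is a single component and cannot communicate with itself.
sound (Parʳ {μ = τᵃ} d _) F (par s t) with sound d F t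
... | _ , _ , _ , communication {who₁ = zero} {zero} 0≢0 _ _ _ _ _ _ , _ = contradiction refl 0≢0
sound (Comˡ d e) F (par s t) with sound d F s | sound e F t
... | _ , u , s′ | _ ∷ [] , w , t′ =
  _ , _ , ↭-refl , Communication-getˡ (λ _ → refl) (λ _ → refl) u w , par s′ t′
sound (Comʳ d e) F (par s t) with sound d F s | sound e F t
... | _ , u , s′ | _ ∷ [] , w , t′ =
  _ , _ , ↭-refl , Communication-putˡ (λ _ → refl) (λ _ → refl) u w , par s′ t′
sound (Closeˡ d e _) F (par s t) with sound e F t
... | _ , L₁ , _ , _ , L≡ , _ = contradiction L≡ ([]≢++∷ L₁)
-- Since `y` is not free in the right operand, that operand keeps its interpretation when `y`
-- denotes the opened channel, and what it receives is this channel.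
sound {ρ = ρ} (Closeʳ {y = y} d e y∉Q) F (par s t) with sound d F s
... | Cs , L₁ , k , L₂ , refl , x≢y , u , s′
  with sound e (Faithful-≔ F) (Sem-ext (λ a∈ → sym (≔-other ρ (ch k) (∈-∉⇒≢ a∈ y∉Q))) t)
... | _ ∷ [] , w , t′ =
  _ , k ∷ L₁ ++ L₂ , shift k L₁ L₂ ,
  Communication-putˡ (λ _ → refl) (λ _ → refl) u
    (subst₂ (λ c v → Move _ _ _ (get c v)) (≔-other ρ _ x≢y) (≔-same ρ y _) w) ,
  res (par s′ t′)
sound (Rep d) F ()
sound (Cong {μ = μ} e d e′) F s =
  Outcome-cong μ (contribution-Cong e d e′) e′ (sound d F (Sem-≅ e s))

-- Alpha-equivalence from equal interpretations

ch-injective : ∀ {k l} → ch k ≡ ch l → k ≡ l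
ch-injective refl = refl

Avoids : Env → Val → Set
Avoids ρ v = ∀ a → ρ a ≢ v

Below : ℕ → Env → Set
Below K ρ = ∀ a {k} → ρ a ≡ ch k → k < K

Reflects : Scope → Env → Env → Set
Reflects Γ ρ σ = ∀ a b → ρ a ≡ σ b → Γ ⊢ a ≈ₙ b

Injective⇒Reflects : ∀ {ρ} → Injective _≡_ _≡_ ρ → Reflects [] ρ ρ
Injective⇒Reflects inj a b eq with inj eq
... | refl = free

Below⇒Avoids : ∀ {K ρ} → Below K ρ → Avoids ρ (ch K)
Below⇒Avoids below a eq = ℕ.<-irrefl refl (below a eq)

Below-≔ : ∀ {K K′ ρ x k} → Below K ρ → K ≤ K′ → k < K′ → Below K′ (ρ [ x ≔ ch k ])
Below-≔ {x = x} below K≤ k< a eq with a ≟ var x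
Below-≔ below K≤ k< a refl | yes _ = k<
Below-≔ below K≤ k< a eq   | no _  = ℕ.≤-trans (below a eq) K≤

Avoids-≔ : ∀ {ρ x v w} → Avoids ρ w → v ≢ w → Avoids (ρ [ x ≔ v ]) w
Avoids-≔ {x = x} avoid v≢w a eq with a ≟ var x
... | yes _ = v≢w eq
... | no _  = avoid a eq

Reflects-∷ : ∀ {Γ ρ σ x y v} → Reflects Γ ρ σ → Avoids ρ v → Avoids σ v →
             Reflects ((x , y) ∷ Γ) (ρ [ x ≔ v ]) (σ [ y ≔ v ])
Reflects-∷ {x = x} {y} h ρ∌ σ∌ a b eq with a ≟ var x | b ≟ var y
... | yes refl | yes refl = here
... | yes _    | no _     = contradiction (sym eq) (σ∌ b)
... | no _     | yes _    = contradiction eq (ρ∌ a)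
... | no a≢x   | no b≢y   = there a≢x b≢y (h a b eq)

Injective-≔ : ∀ {ρ x v} → Injective _≡_ _≡_ ρ → Avoids ρ v → Injective _≡_ _≡_ (ρ [ x ≔ v ])
Injective-≔ {x = x} inj avoid {a} {b} eq with a ≟ var x | b ≟ var x
... | yes refl | yes refl = refl
... | yes _    | no _     = contradiction (sym eq) (avoid b)
... | no _     | yes _    = contradiction eq (avoid a)
... | no _     | no _     = inj eq

-- An interpretation leaves open only the bound names and the order of summands. Summands are
-- matched through the common list of branches, and `Reflects` recovers related names from equal
-- values.
Sem⇒≈ : ∀ {Γ ρ σ K P Q m} {Bs : Vec Beh (suc m)} → Reflects Γ ρ σ → Below K ρ → Below K σ →
        Sem ρ P [] Bs → Sem σ Q [] Bs → Γ ⊢ P ≈ Q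
SemPrefixed⇒≈ : ∀ {Γ ρ σ K α β P Q b} → Reflects Γ ρ σ → Below K ρ → Below K σ →
                SemPrefixed ρ α P b → SemPrefixed σ β Q b →
                ∃[ Δ ] Γ ⊢ α ≈ₚ β ⊣ Δ × Δ ⊢ P ≈ Q

Sem⇒≈ {σ = σ} h ρ< σ< (sum π s) (sum {α = β} {Q} {B} θ t) =
  sum (π ∘ₚ flip θ) (proj₁ ∘ matched) (proj₁ ∘ proj₂ ∘ matched) (proj₂ ∘ proj₂ ∘ matched)
  where
  matched : ∀ i → _
  matched i = SemPrefixed⇒≈ h ρ< σ< (s i)
    (subst (λ j → SemPrefixed σ (β (θ ⟨$⟩ˡ (π ⟨$⟩ʳ i))) (Q (θ ⟨$⟩ˡ (π ⟨$⟩ʳ i)))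
                              (List.lookup (branches B) j))
           (Perm.inverseʳ θ) (t (θ ⟨$⟩ˡ (π ⟨$⟩ʳ i))))
Sem⇒≈ h ρ< σ< (par s t) (par s′ t′) = par (Sem⇒≈ h ρ< σ< s s′) (Sem⇒≈ h ρ< σ< t t′)

-- An input is compared at a channel fresh for both environments.
SemPrefixed⇒≈ {K = K} h ρ< σ< (recv refl s) (recv eq t) =
  _ , input (h _ _ (sym eq)) ,
  Sem⇒≈ (Reflects-∷ h (Below⇒Avoids ρ<) (Below⇒Avoids σ<))
        (Below-≔ ρ< (ℕ.n≤1+n K) (ℕ.n<1+n K)) (Below-≔ σ< (ℕ.n≤1+n K) (ℕ.n<1+n K))
        (s (ch K)) (t (ch K))
SemPrefixed⇒≈ h ρ< σ< (send refl refl s) (send eq eq′ t) =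
  _ , output (h _ _ (sym eq)) (h _ _ (sym eq′)) , Sem⇒≈ h ρ< σ< s t

νs : List (Var × ℕ) → Proc → Proc
νs ps P = List.foldr ν P (List.map proj₁ ps)

extend : Env → List (Var × ℕ) → Env
extend ρ []             = ρ
extend ρ ((x , k) ∷ ps) = extend (ρ [ x ≔ ch k ]) ps

Sem-νs : ∀ {ρ m P} {Bs : Vec Beh (suc m)} ps → Sem (extend ρ ps) P [] Bs →
         Sem ρ (νs ps P) (List.map proj₂ ps) Bs
Sem-νs []       s = s
Sem-νs (_ ∷ ps) s = res (Sem-νs ps s)

Sem-νs⁻ : ∀ {ρ m P} {Bs : Vec Beh (suc m)} ps → Sem ρ (νs ps P) (List.map proj₂ ps) Bs →
          Sem (extend ρ ps) P [] Bs
Sem-νs⁻ []       s       = s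
Sem-νs⁻ (_ ∷ ps) (res s) = Sem-νs⁻ ps s

-- The bound K leaves channels for the inputs under the restrictions valued by L.
record Apart (K : ℕ) (ρ : Env) (L : List ℕ) : Set where
  constructor apart
  field
    ρ-below   : Below K ρ
    L-below   : All (_< K) L
    L-avoided : All (Avoids ρ ∘ ch) L
    L-unique  : Unique L

Apart-≔ : ∀ {K ρ x k L} → Apart K ρ (k ∷ L) → Apart K (ρ [ x ≔ ch k ]) L
Apart-≔ (apart ρ< (k< ∷ L<) (_ ∷ L∌) (k≢ ∷ L!)) =
  apart (Below-≔ ρ< ℕ.≤-refl k<) L<
        (All.map (λ (∌ , ≢) → Avoids-≔ ∌ (≢ ∘ ch-injective)) (All.zip (L∌ , k≢))) L!

Sem⇒≈-νs : ∀ {Γ ρ σ K P Q m} {Bs : Vec Beh (suc m)} ps qs →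
           List.map proj₂ qs ≡ List.map proj₂ ps → Reflects Γ ρ σ →
           Apart K ρ (List.map proj₂ ps) → Apart K σ (List.map proj₂ ps) →
           Sem (extend ρ ps) P [] Bs → Sem (extend σ qs) Q [] Bs → Γ ⊢ νs ps P ≈ νs qs Q
Sem⇒≈-νs []             []             refl h (apart ρ< _ _ _) (apart σ< _ _ _) s t =
  Sem⇒≈ h ρ< σ< s t
Sem⇒≈-νs ((x , k) ∷ ps) ((y , l) ∷ qs) eq h A A′ s t with List.∷-injective eq
... | refl , eq′ =
  res (Sem⇒≈-νs ps qs eq′ (Reflects-∷ h (All.head (Apart.L-avoided A)) (All.head (Apart.L-avoided A′)))
                (Apart-≔ A) (Apart-≔ A′) s t)

-- Prenex form

νs-cong : ∀ ps {P Q} → P ≅ Q → νs ps P ≅ νs ps Q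
νs-cong []       e = e
νs-cong (_ ∷ ps) e = ν-cong (νs-cong ps e)

_#_ : List (Var × ℕ) → List Name → Set
ps # ns = ∀ {x} → x ∈ List.map proj₁ ps → var x ∉ ns

extrude-νs : ∀ ps {P Q} → ps # fn Q → νs ps P ∣ Q ≅ νs ps (P ∣ Q)
extrude-νs []       #Q = ≅-refl
extrude-νs (_ ∷ ps) #Q = ≅-trans (extrude (#Q (here refl))) (ν-cong (extrude-νs ps (#Q ∘ there)))

extend-# : ∀ {ρ ns a} ps → ps # ns → a ∈ ns → ρ a ≡ extend ρ ps a
extend-# []                 # a∈ = refl
extend-# {ρ} ((x , k) ∷ ps) # a∈ =
  trans (sym (≔-other ρ (ch k) (∈-∉⇒≢ a∈ (# (here refl))))) (extend-# ps (# ∘ there) a∈)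

freshen : List Name → List (Var × ℕ) → List (Var × ℕ)
freshen av []             = []
freshen av ((_ , k) ∷ ps) = (fresh av , k) ∷ freshen (var (fresh av) ∷ av) ps

freshen-values : ∀ av ps → List.map proj₂ (freshen av ps) ≡ List.map proj₂ ps
freshen-values av []             = refl
freshen-values av ((_ , k) ∷ ps) = cong (k ∷_) (freshen-values _ ps)

freshen-# : ∀ av ps → freshen av ps # av
freshen-# av (_ ∷ ps) (here refl) = fresh-∉ av
freshen-# av (_ ∷ ps) (there x∈)  = freshen-# _ ps x∈ ∘ there

freshen-unique : ∀ av ps → Unique (List.map proj₁ (freshen av ps))
freshen-unique av []       = []
freshen-unique av (_ ∷ ps) =
  All.tabulate (λ x∈ → λ { refl → freshen-# _ ps x∈ (here refl) }) ∷ freshen-unique _ ps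

ren-νs : ∀ av f ps P → ∃[ Q ] ren av f (νs ps P) ≡ νs (freshen av ps) Q
ren-νs av f []       P = _ , refl
ren-νs av f (_ ∷ ps) P with ren-νs _ _ ps P
... | Q , eq = Q , cong (ν (fresh av)) eq

record Prenex (ns : List Name) (ρ : Env) (P : Proc) (L : List ℕ) {m} (Bs : Vec Beh (suc m)) : Set where
  field
    prefix   : List (Var × ℕ)
    matrix   : Proc
    values   : List.map proj₂ prefix ≡ L
    unique   : Unique (List.map proj₁ prefix)
    avoids   : prefix # ns
    equiv    : P ≅ νs prefix matrix
    sem      : Sem (extend ρ prefix) matrix [] Bs

-- At a restriction the prefix found so far may clash with `x` or `ns`, so the whole prefix is
-- renamed by `ren`. The alpha-conversion is then read off from the equality of interpretations.
prenex : ∀ {K ρ P L m} {Bs : Vec Beh (suc m)} ns → Injective _≡_ _≡_ ρ → Apart K ρ L →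
         Sem ρ P L Bs → Prenex ns ρ P L Bs
prenex ns inj A s@(sum _ _) = record
  { prefix = [] ; values = refl ; unique = [] ; avoids = λ () ; equiv = ≅-refl ; sem = s }
prenex ns inj A (par {P = P} {Q} s t) = record
  { prefix = p.prefix ; values = p.values ; unique = p.unique
  ; avoids = λ x∈ → p.avoids x∈ ∘ ∈-++⁺ˡ
  ; equiv  = ≅-trans (∣-cong p.equiv ≅-refl) (extrude-νs p.prefix Q#)
  ; sem    = par p.sem (Sem-ext (extend-# p.prefix Q#) t)
  }
  where
  -- Avoiding `fn Q` as well is what permits the extrusion over `Q`.
  module p = Prenex (prenex (ns ++ fn Q) inj A s)
  Q# : p.prefix # fn Q
  Q# x∈ = p.avoids x∈ ∘ ∈-++⁺ʳ ns
prenex {ρ = ρ} {Bs = Bs} ns inj A (res {x} {P} {k} {L} s) = record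
  { prefix = qs
  ; values = trans (freshen-values av ps) (cong (k ∷_) p.values)
  ; unique = freshen-unique av ps
  ; avoids = λ x∈ → freshen-# av ps x∈ ∘ ∈-++⁺ˡ
  ; equiv  = ≅-trans (ν-cong p.equiv) (alpha (Sem⇒≈-νs ps qs (freshen-values av ps)
               (Injective⇒Reflects inj) A′ A′ p.sem sem′))
  ; sem    = sem′
  }
  where
  module p = Prenex (prenex [] (Injective-≔ inj (All.head (Apart.L-avoided A))) (Apart-≔ A) s)
  ps = (x , k) ∷ p.prefix
  av = ns ++ fn (νs ps p.matrix)
  qs = freshen av ps
  A′ : Apart _ ρ (List.map proj₂ ps)
  A′ = subst (λ L → Apart _ ρ (k ∷ L)) (sym p.values) A
  sem′ : Sem (extend ρ qs) (proj₁ (ren-νs av id ps p.matrix)) [] _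
  sem′ = Sem-νs⁻ qs (subst₂ (λ P L → Sem ρ P L Bs) (proj₂ (ren-νs av id ps p.matrix))
                            (sym (freshen-values av ps))
                            (Sem-ren (λ _ → refl) (∈-++⁺ʳ ns) (Sem-νs ps p.sem)))

-- Numbering of positions

pair : ℕ → ℕ → ℕ
pair zero    n = suc (2 * n)
pair (suc m) n = 2 * pair m n

pair≢0 : ∀ m n → pair m n ≢ 0
pair≢0 (suc m) n eq = pair≢0 m n (ℕ.m+n≡0⇒m≡0 (pair m n) eq)

pair-injective : ∀ m m′ n n′ → pair m n ≡ pair m′ n′ → m ≡ m′ × n ≡ n′
pair-injective zero    zero     n n′ eq = refl , ℕ.*-cancelˡ-≡ n n′ 2 (ℕ.suc-injective eq)
pair-injective zero    (suc m′) n n′ eq = contradiction (sym eq) (ℕ.even≢odd (pair m′ n′) n)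
pair-injective (suc m) zero     n n′ eq = contradiction eq (ℕ.even≢odd (pair m n) n′)
pair-injective (suc m) (suc m′) n n′ eq
  with pair-injective m m′ n n′ (ℕ.*-cancelˡ-≡ (pair m n) (pair m′ n′) 2 eq)
... | refl , eq′ = refl , eq′

-- Here `pair m n` is 2^m * (2 * n + 1), which is injective and never 0, the code of the empty list.
encode : List ℕ → ℕ
encode []      = 0
encode (m ∷ c) = pair m (encode c)

encode-injective : ∀ c d → encode c ≡ encode d → c ≡ d
encode-injective []      []      eq = refl
encode-injective []      (n ∷ d) eq = contradiction (sym eq) (pair≢0 n _)
encode-injective (m ∷ c) []      eq = contradiction eq (pair≢0 m _)
encode-injective (m ∷ c) (n ∷ d) eq with pair-injective m n (encode c) (encode d) eq
... | refl , eq′ = cong (m ∷_) (encode-injective c d eq′)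

-- Positions are stored from leaf to root, so two positions in different branches at `r` differ in
-- the entry just before the common suffix `r`.
++-∷-injective : ∀ {A : Set} (p q : List A) {x y r} → p ++ x ∷ r ≡ q ++ y ∷ r → x ≡ y
++-∷-injective p q {x} {y} {r} eq = List.∷ʳ-injectiveʳ p q (List.++-cancelʳ r _ _
  (trans (List.++-assoc p (x ∷ []) r) (trans eq (sym (List.++-assoc q (y ∷ []) r)))))

-- Renaming with distinct binders: each binder of a sequential process is
-- named after its position in the syntax tree.

module Refresh (base : ℕ) where

  binder : List ℕ → Var
  binder c = base + encode c

  binder-injective : ∀ c d → binder c ≡ binder d → c ≡ d
  binder-injective c d eq = encode-injective c d (ℕ.+-cancelˡ-≡ base (encode c) (encode d) eq)

  refreshPrefix : List ℕ → (Name → Name) → Prefix → Prefix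
  refreshPrefix c f (a ⟨ x ⟩ⁱ) = f a ⟨ binder c ⟩ⁱ
  refreshPrefix c f (a ⟨ b ⟩ᵒ) = f a ⟨ f b ⟩ᵒ
  refreshPrefix c f τ          = τ

  under : List ℕ → (Name → Name) → Prefix → Name → Name
  under c f (a ⟨ x ⟩ⁱ) = f [ x ↦ var (binder c) ]
  under c f _          = f

  refresh : List ℕ → (Name → Name) → Proc → Proc
  refresh c f (∑ α P) = ∑ (λ i → refreshPrefix (toℕ i ∷ c) f (α i))
                          (λ i → refresh (toℕ i ∷ c) (under (toℕ i ∷ c) f (α i)) (P i))
  -- A default: a process interpreted by one behaviour without restrictions is always a sum.
  refresh c f _       = ∑ {0} (λ ()) (λ ())

  -- Binders still to be introduced have positions of length at least `n`; `f` must not produce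
  -- them.
  Clear : ℕ → (Name → Name) → List Name → Set
  Clear n f ns = ∀ {a} d → a ∈ ns → n ≤ length d → f a ≢ var (binder d)

  Clear-under : ∀ {c f x ns} → Clear (length c) f (remove x ns) →
                Clear (suc (length c)) (f [ x ↦ var (binder c) ]) ns
  Clear-under {c} {x = x} clear {a} d a∈ c< eq with a ≟ var x
  ... | yes _  = ℕ.<⇒≢ c< (cong length (binder-injective c d (var-injective eq)))
  ... | no a≢x = clear d (∈-remove a∈ a≢x) (ℕ.<⇒≤ c<) eq

  -- The bound is one more than for a prefix: the guards of a sum at `c` have positions one entry
  -- longer than `c`.
  Sem-refresh : ∀ {ρ σ c f P B} → (∀ {a} → a ∈ fn P → ρ (f a) ≡ σ a) → Clear (suc (length c)) f (fn P) →
                Sem σ P [] (B ∷ []) → Sem ρ (refresh c f P) [] (B ∷ [])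
  SemPrefixed-refresh : ∀ {ρ σ c f α P b} → (∀ {a} → a ∈ fnPrefixed α (fn P) → ρ (f a) ≡ σ a) →
                        Clear (length c) f (fnPrefixed α (fn P)) → SemPrefixed σ α P b →
                        SemPrefixed ρ (refreshPrefix c f α) (refresh c (under c f α) P) b

  Sem-refresh h g (sum {α = α} {P} π s) = sum π λ i →
    SemPrefixed-refresh (λ a∈ → h (∈-∑⁺ α P i a∈)) (λ d a∈ → g d (∈-∑⁺ α P i a∈)) (s i)

  SemPrefixed-refresh {ρ} {σ} {c} {f} h g (recv refl s) =
    recv (h (here refl))
         λ v → Sem-refresh (under-env ρ σ f (h ∘ there) λ a∈ → g c (there a∈) ℕ.≤-refl)
                                   (Clear-under {c} {f} (λ d a∈ → g d (there a∈))) (s v)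
  SemPrefixed-refresh h g (send refl refl s) =
    send (h (here refl)) (h (there (here refl)))
         (Sem-refresh (λ a∈ → h (there (there a∈))) (λ d a∈ c< → g d (there (there a∈)) (ℕ.<⇒≤ c<)) s)

  fn-refresh : ∀ c f P {a} → a ∈ fn (refresh c f P) → ∃[ b ] b ∈ fn P × a ≡ f b
  fn-refreshPrefix : ∀ c f α P {a} → a ∈ fnPrefixed (refreshPrefix c f α) (fn (refresh c (under c f α) P)) →
                     ∃[ b ] b ∈ fnPrefixed α (fn P) × a ≡ f b

  fn-refresh c f (∑ α P) a∈
    with ∈-∑⁻ (λ i → refreshPrefix (toℕ i ∷ c) f (α i))
              (λ i → refresh (toℕ i ∷ c) (under (toℕ i ∷ c) f (α i)) (P i)) a∈
  ... | i , a∈i with fn-refreshPrefix (toℕ i ∷ c) f (α i) (P i) a∈i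
  ... | b , b∈ , eq = b , ∈-∑⁺ α P i b∈ , eq

  fn-refreshPrefix c f (a ⟨ x ⟩ⁱ) P (here refl) = a , here refl , refl
  fn-refreshPrefix c f (a ⟨ x ⟩ⁱ) P (there b∈)
    with ∈-remove⁻ (fn (refresh c (f [ x ↦ var (binder c) ]) P)) b∈
  ... | b∈′ , b≢ with fn-refresh c (f [ x ↦ var (binder c) ]) P b∈′
  ... | b , b∈P , eq with b ≟ var x
  ...   | yes _  = contradiction eq b≢
  ...   | no b≢x = b , there (∈-remove b∈P b≢x) , eq
  fn-refreshPrefix c f (a ⟨ b ⟩ᵒ) P (here refl)         = a , here refl , refl
  fn-refreshPrefix c f (a ⟨ b ⟩ᵒ) P (there (here refl)) = b , there (here refl) , refl
  fn-refreshPrefix c f (a ⟨ b ⟩ᵒ) P (there (there d∈)) with fn-refresh c f P d∈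
  ... | d , d∈P , eq = d , there (there d∈P) , eq
  fn-refreshPrefix c f τ          P d∈ = fn-refresh c f P d∈

  boundAt : List ℕ → (Name → Name) → Prefix → Proc → List Var
  boundAt c f α P = boundPrefix (refreshPrefix c f α) ++ bound (refresh c (under c f α) P)

  bound-refresh : ∀ c f P {x} → x ∈ bound (refresh c f P) → ∃[ p ] ∃[ m ] x ≡ binder (p ++ m ∷ c)
  bound-refreshAt : ∀ c f α P {x} → x ∈ boundAt c f α P → ∃[ p ] x ≡ binder (p ++ c)

  bound-refresh c f (∑ α P) x∈
    with ∈-concat⁻′ (List.tabulate λ i → boundAt (toℕ i ∷ c) f (α i) (P i)) x∈
  ... | _ , x∈i , i∈ with ∈-tabulate⁻ i∈
  ... | i , refl with bound-refreshAt (toℕ i ∷ c) f (α i) (P i) x∈i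
  ... | p , eq = p , toℕ i , eq

  bound-refreshAt c f α P x∈ with ∈-++⁻ (boundPrefix (refreshPrefix c f α)) x∈
  bound-refreshAt c f (a ⟨ x ⟩ⁱ) P x∈ | inj₁ (here refl) = [] , refl
  bound-refreshAt c f α P x∈ | inj₂ x∈P with bound-refresh c (under c f α) P x∈P
  ... | p , m , refl = p ++ m ∷ [] , cong binder (sym (List.++-assoc p (m ∷ []) c))

  bound-refresh-unique : ∀ c f P → Unique (bound (refresh c f P))
  bound-refreshAt-unique : ∀ c f α P → Unique (boundAt c f α P)

  bound-refresh-unique c f (∑ α P) = Unique.concat⁺
    (All.tabulate⁺ λ i → bound-refreshAt-unique (toℕ i ∷ c) f (α i) (P i))
    (AllPairs.tabulate⁺ λ {i} {j} i≢j (x∈i , x∈j) → disjoint i j i≢j x∈i x∈j)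
    where
    disjoint : ∀ i j → i ≢ j → ∀ {x} → x ∈ boundAt (toℕ i ∷ c) f (α i) (P i) →
               x ∉ boundAt (toℕ j ∷ c) f (α j) (P j)
    disjoint i j i≢j x∈i x∈j
      with bound-refreshAt _ f (α i) (P i) x∈i | bound-refreshAt _ f (α j) (P j) x∈j
    ... | p , eq | q , eq′ =
      i≢j (Fin.toℕ-injective (++-∷-injective p q
        (binder-injective (p ++ toℕ i ∷ c) (q ++ toℕ j ∷ c) (trans (sym eq) eq′))))
  bound-refresh-unique c f (ν _ _) = []
  bound-refresh-unique c f (_ ∣ _) = []
  bound-refresh-unique c f (! _)   = []

  bound-refreshAt-unique c f (a ⟨ x ⟩ⁱ) P = All.tabulate apart′ ∷ bound-refresh-unique c _ P
    where
    apart′ : ∀ {y} → y ∈ bound (refresh c (f [ x ↦ var (binder c) ]) P) → binder c ≢ y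
    apart′ y∈ refl with bound-refresh c _ P y∈
    -- Binders of the continuation have strictly longer positions than the input itself.
    ... | p , m , eq = ℕ.<⇒≢ (ℕ.≤-trans (ℕ.n<1+n _) (ℕ.m≤n+m (suc (length c)) (length p)))
                             (trans (cong length (binder-injective c (p ++ m ∷ c) eq)) (List.length-++ p))
  bound-refreshAt-unique c f (a ⟨ b ⟩ᵒ) P = bound-refresh-unique c f P
  bound-refreshAt-unique c f τ          P = bound-refresh-unique c f P

-- Networks with given sequential components

module _ (xs : List Var) (xs! : Unique xs) (P : Fin 4 → Proc) where

  private
    base : ℕ
    base = fresh (List.map var xs ++ concat (List.tabulate (fn ∘ P)))

  open Refresh base

  refreshed : Fin 4 → Proc
  refreshed i = refresh (toℕ i ∷ []) id (P i)

  xs<base : ∀ {x} → x ∈ xs → x < base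
  xs<base x∈ = fresh-bound _ (∈-++⁺ˡ (∈-map⁺ var x∈))

  fn<base : ∀ i {x} → var x ∈ fn (P i) → x < base
  fn<base i x∈ = fresh-bound _ (∈-++⁺ʳ (List.map var xs) (∈-concat⁺′ x∈ (∈-tabulate⁺ {f = fn ∘ P} i)))

  Sem-refreshed : ∀ i {ρ B} → Sem ρ (P i) [] (B ∷ []) → Sem ρ (refreshed i) [] (B ∷ [])
  Sem-refreshed i = Sem-refresh (λ _ → refl)
    (λ { _ a∈ _ refl → ℕ.<⇒≱ (fn<base i a∈) (ℕ.m≤m+n base _) })

  private
    body : Proc
    body = refreshed 0F ∣ refreshed 1F ∣ refreshed 2F ∣ refreshed 3F

    bound-body : List Var
    bound-body = concat (List.tabulate (bound ∘ refreshed))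

    base≤bound : ∀ {x} → x ∈ bound-body → base ≤ x
    -- The four components are viewed as summands of one sum whose silent prefixes add no binders,
    -- so the facts about `refresh` apply to all of them at once.
    base≤bound x∈ with bound-refresh [] id (∑ (λ _ → τ) P) x∈
    ... | _ , _ , refl = ℕ.m≤m+n base _

    body-below : ∀ {x} → var x ∈ fn body → x < base
    body-below x∈ with ∈-fn₄ refreshed x∈
    ... | i , x∈i with fn-refresh (toℕ i ∷ []) id (P i) x∈i
    ... | _ , b∈ , refl = fn<base i b∈

  network : Network 3
  network .restricted = xs
  network .Network.components = Vec.tabulate refreshed
  network .Network.bound-distinct =
    Unique.++⁺ xs! (bound-refresh-unique [] id (∑ (λ _ → τ) P))
      λ (x∈ , x∈′) → ℕ.<⇒≱ (xs<base x∈) (base≤bound x∈′)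
  network .Network.bound-not-free x∈ x∈fn = ℕ.<⇒≱ (body-below x∈fn) (base≤bound x∈)

-- Processes represented by four behaviours

channels : List ℕ
channels = 0 ∷ 1 ∷ 2 ∷ 3 ∷ []

apart-nm : ∀ {L} → L ↭ channels → Apart 4 nm L
apart-nm L↭ = apart (λ _ ()) (All-resp-↭ (↭-sym L↭) 0123<4) (All.tabulate λ _ _ ())
  (PermutationSetoid.Unique-resp-↭ (setoid ℕ) (↭⇒↭ₛ (↭-sym L↭)) (Unique.upTo⁺ 4))
  where
  0123<4 : All (_< 4) channels
  0123<4 = s≤s z≤n ∷ s≤s (s≤s z≤n) ∷ s≤s (s≤s (s≤s z≤n)) ∷ s≤s (s≤s (s≤s (s≤s z≤n))) ∷ []

nm-injective : ∀ {a b} → nm a ≡ nm b → a ≡ b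
nm-injective refl = refl

-- The order of the channels is left open because closing moves a restriction to the front.
record Represents (P : Proc) (Bs : Vec Beh 4) : Set where
  constructor represents
  field
    {values} : List ℕ
    values↭  : values ↭ channels
    sem      : Sem nm P values Bs

-- The prenex form collects the restrictions, and `refresh` makes the binders distinct; as it
-- preserves the interpretation, it is an alpha-conversion.
toNetwork : ∀ {P Bs} → Represents P Bs → Σ[ N ∈ Network 3 ] P ≅ process N
toNetwork {P} (represents {L} L↭ s) = from (prenex [] nm-injective (apart-nm L↭) s)
  where
  from : ∀ {Bs : Vec Beh 4} → Prenex [] nm P L Bs → Σ[ N ∈ Network 3 ] P ≅ process N
  from record { prefix = ps ; values = refl ; unique = ps! ; equiv = equiv
              ; sem = par {Q = Q₃} (par {Q = Q₂} (par {P = Q₀} {Q = Q₁} s₀ s₁) s₂) s₃ } =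
    network (List.map proj₁ ps) ps! Q ,
    ≅-trans equiv (alpha (Sem⇒≈-νs ps ps refl (Injective⇒Reflects nm-injective) (apart-nm L↭) (apart-nm L↭)
      (par (par (par s₀ s₁) s₂) s₃)
      (par (par (par (refreshed-sem 0F s₀) (refreshed-sem 1F s₁)) (refreshed-sem 2F s₂)) (refreshed-sem 3F s₃))))
    where
    Q : Fin 4 → Proc
    Q = λ { 0F → Q₀ ; 1F → Q₁ ; 2F → Q₂ ; 3F → Q₃ }
    refreshed-sem : ∀ i {Bs : Vec Beh 1} → Sem (extend nm ps) (Q i) [] Bs →
                    Sem (extend nm ps) (refreshed (List.map proj₁ ps) ps! Q i) [] Bs
    refreshed-sem i {_ ∷ []} = Sem-refreshed (List.map proj₁ ps) ps! Q i

-- Progress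

branchAt : ∀ {ρ n} {α : Fin n → Prefix} {P : Fin n → Proc} {B b} → Sem ρ (∑ α P) [] (B ∷ []) →
           b ∈ branches B → ∃[ i ] SemPrefixed ρ (α i) (P i) b
branchAt {ρ} {α = α} {P} {B} (sum π s) b∈ =
  i , subst (SemPrefixed ρ (α i) (P i)) (sym (lookup-index b∈))
        (subst (λ j → SemPrefixed ρ (α i) (P i) (List.lookup (branches B) j)) (Perm.inverseʳ π) (s i))
  where
  i : Fin _
  i = π ⟨$⟩ˡ index b∈

isInput : ∀ {ρ α P c k} → SemPrefixed ρ α P (recv c k) → ∃[ a ] ∃[ x ] α ≡ a ⟨ x ⟩ⁱ × ρ a ≡ c
isInput (recv eq _) = _ , _ , refl , eq

isOutput : ∀ {ρ α P c v B} → SemPrefixed ρ α P (send c v B) →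
           ∃[ a ] ∃[ b ] α ≡ a ⟨ b ⟩ᵒ × ρ a ≡ c × ρ b ≡ v
isOutput (send eq eq′ _) = _ , _ , refl , eq , eq′

Gets : Env → Proc → Val → Set
Gets ρ P c = ∀ b → ∃[ a ] ∃[ P′ ] (P —[ inᵃ a b ]→ P′) × ρ a ≡ c

Puts : Env → Proc → Val → Val → Set
Puts ρ P c v = ∃[ a ] ∃[ b ] ∃[ P′ ] (P —[ outᵃ a b ]→ P′) × ρ a ≡ c × ρ b ≡ v

gets : ∀ {ρ P m} {Bs : Vec Beh (suc m)} {c v C} i → Sem ρ P [] Bs → lookup Bs i ⇑[ get c v ] C → Gets ρ P c
gets zero s@(sum _ _) (get _ b∈) b with branchAt s b∈
... | j , t with isInput t
... | a , _ , α≡ , eq = a , _ , I-Sum j b α≡ , eq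
gets zero (par s t) o b with gets zero t o b
... | a , _ , d , eq = a , _ , Parʳ d (λ { (() , _) }) , eq
gets (suc i) (par s t) o b with gets i s o b
... | a , _ , d , eq = a , _ , Parˡ d (λ { (() , _) }) , eq

puts : ∀ {ρ P m} {Bs : Vec Beh (suc m)} {c v C} i → Sem ρ P [] Bs → lookup Bs i ⇑[ put c v ] C → Puts ρ P c v
puts zero s@(sum _ _) (put b∈) with branchAt s b∈
... | j , t with isOutput t
... | a , b , α≡ , eq = a , b , _ , O-Sum j α≡ , eq
puts zero (par s t) o with puts zero t o
... | a , b , _ , d , eq = a , b , _ , Parʳ d (λ { (() , _) }) , eq
puts (suc i) (par s t) o with puts i s o
... | a , b , _ , d , eq = a , b , _ , Parˡ d (λ { (() , _) }) , eq

-- The restrictions have been moved outside, so the partners exchange a free name and no closing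
-- occurs. The early input is asked for exactly the name sent, and injectivity turns equal channel
-- values into equal names.
communicates : ∀ {ρ P m} {Bs : Vec Beh (suc m)} {c v B C} i j → Injective _≡_ _≡_ ρ → i ≢ j → Sem ρ P [] Bs →
               lookup Bs i ⇑[ get c v ] B → lookup Bs j ⇑[ put c v ] C → ∃[ P′ ] (P —[ τᵃ ]→ P′)
communicates zero zero inj 0≢0 s o o′ = contradiction refl 0≢0
communicates zero (suc j) inj _ (par s t) o o′ with puts j s o′
... | a , b , _ , d , eq , _ with gets zero t o b
... | a′ , _ , e , eq′ with inj (trans eq (sym eq′))
... | refl = _ , Comʳ d e
communicates (suc i) zero inj _ (par s t) o o′ with puts zero t o′
... | a , b , _ , d , eq , _ with gets i s o b
... | a′ , _ , e , eq′ with inj (trans eq (sym eq′))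
... | refl = _ , Comˡ e d
communicates (suc i) (suc j) inj i≢j (par s t) o o′ with communicates i j inj (i≢j ∘ cong suc) s o o′
... | _ , d = _ , Parˡ d (λ { (() , _) })
communicates zero    (suc ()) inj _ (sum _ _) o o′
communicates (suc ()) _       inj _ (sum _ _) o o′

νs-step : ∀ {P μ P′} ps → ps # names μ → P —[ μ ]→ P′ → νs ps P —[ μ ]→ νs ps P′
νs-step []       # d = d
νs-step (_ ∷ ps) # d = Res (νs-step ps (# ∘ there) d) (# (here refl))

extend-injective : ∀ {K ρ} ps → Injective _≡_ _≡_ ρ → Apart K ρ (List.map proj₂ ps) →
                   Injective _≡_ _≡_ (extend ρ ps)
extend-injective []       inj A = inj
extend-injective (_ ∷ ps) inj A =
  extend-injective ps (Injective-≔ inj (All.head (Apart.L-avoided A))) (Apart-≔ A)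

≔-restricted : ∀ ρ {y l} a → ∃[ k ] ρ a ≡ ch k → ∃[ k ] (ρ [ y ≔ ch l ]) a ≡ ch k
≔-restricted ρ {y} {l} a eq with a ≟ var y
... | yes _ = l , refl
... | no _  = eq

extend-restricted : ∀ {ρ x} ps → (x ∈ List.map proj₁ ps ⊎ ∃[ k ] ρ (var x) ≡ ch k) →
                    ∃[ k ] extend ρ ps (var x) ≡ ch k
extend-restricted []             (inj₂ eq) = eq
extend-restricted {ρ} {x} ((y , l) ∷ ps) p = extend-restricted ps (update p)
  where
  update : x ∈ y ∷ List.map proj₁ ps ⊎ ∃[ k ] ρ (var x) ≡ ch k →
           x ∈ List.map proj₁ ps ⊎ ∃[ k ] (ρ [ y ≔ ch l ]) (var x) ≡ ch k
  update (inj₁ (there x∈))  = inj₁ x∈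
  update (inj₁ (here refl)) = inj₂ (l , ≔-same ρ y (ch l))
  update (inj₂ (k , eq))    = inj₂ (≔-restricted ρ (var x) (k , eq))

-- Restricted names denote channels, so the names of an announcement are not among them and `Res`
-- applies.
unrestricted : ∀ {ps a b} → extend nm ps a ≡ nm b → ∀ {x} → x ∈ List.map proj₁ ps → var x ≢ a
unrestricted {ps} eq x∈ refl with extend-restricted {nm} ps (inj₁ x∈)
... | _ , eq′ with trans (sym eq) eq′
... | ()

-- The proof tree is built on the prenex form and carried back by `Cong`. Its target is represented
-- by reading the tree with `sound`, which need not return the vector `Cs` that was asked for.
canMove : ∀ {P Bs Cs} → Represents P Bs → Bs ⟹ Cs →
          ∃[ μ ] ∃[ Q ] (P —[ μ ]→ Q) × ∃[ Cs′ ] Represents Q Cs′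
canMove {P} {Bs} (represents {L} L↭ s) = from (prenex [] nm-injective (apart-nm L↭) s)
  where
  from : ∀ {Cs} → Prenex [] nm P L Bs → Bs ⟹ Cs → ∃[ μ ] ∃[ Q ] (P —[ μ ]→ Q) × ∃[ Cs′ ] Represents Q Cs′
  from record { prefix = ps ; values = refl ; equiv = equiv ; sem = t } (comm {i} {j} i≢j o o′)
    with communicates i j (extend-injective ps nm-injective (apart-nm L↭)) i≢j t o o′
  ... | _ , d with Cong equiv (νs-step ps (λ _ ()) d) ≅-refl
  ... | d′ with sound d′ (λ _ → nm) s
  ... | _ , _ , L↭L′ , _ , s′ = _ , _ , d′ , _ , represents (↭-trans (↭-sym L↭L′) L↭) s′
  from record { prefix = ps ; values = refl ; equiv = equiv ; sem = t } (announce {i} o)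
    with puts i t o
  ... | a , b , _ , d , eq , eq′
    with Cong equiv (νs-step ps (λ { x∈ (here refl)         → unrestricted {ps} eq x∈ refl
                                   ; x∈ (there (here refl)) → unrestricted {ps} eq′ x∈ refl }) d) ≅-refl
  ... | d′ with sound d′ (λ _ → nm) s
  ... | _ , _ , s′ = _ , _ , d′ , _ , represents L↭ s′

progress : ∀ {N : Network 3} {Bs Cs} → Represents (process N) Bs → Bs ⟹ Cs → Σ[ N′ ∈ Network 3 ] Step N N′
progress r t with canMove r t
... | _ , _ , d , _ , r′ with toNetwork r′
... | N′ , e = N′ , step (Cong ≅-refl d e)

-- Observing steps

-- `path` counts components from the right, `position` from the left.
path-position : ∀ i → path (opposite i) ≡ position 3 i
path-position 0F = refl
path-position 1F = refl
path-position 2F = refl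
path-position 3F = refl

Quiet : Maybe Action → Set
Quiet ma = ∀ μ → ma ≡ just μ → subject μ ≢ just out

data Observed {N N′ : Network 3} (st : Step N N′) (Bs : Vec Beh 4) : Vec Beh 4 → Set where
  internal  : ∀ {i j B C} → Working (lookup Bs i) → Working (lookup Bs j) → Working B → Working C →
              label st ≡ τᵃ → (∀ (k : Fin 4) → Quiet (contribution (tree st) (path k))) →
              Observed st Bs (Bs [ i ]≔ B [ j ]≔ C)
  announces : ∀ {i n} → Working (lookup Bs i) →
              label st ≡ outᵃ out (ident n) →
              contribution (tree st) (path i) ≡ just (outᵃ out (ident n)) →
              (∀ k → k ≢ i → contribution (tree st) (path k) ≡ nothing) →
              Observed st Bs (Bs [ i ]≔ done n)

offering : ∀ {B ℓ C} → B ⇑[ ℓ ] C → Working B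
offering (get _ ()) n refl
offering (put ())   n refl

Safe-get : ∀ {B c v C} → All Safe (branches B) → B ⇑[ get c v ] C → ∃[ k ] c ≡ ch k
Safe-get safe (get v b∈) with All.lookup safe b∈
... | recv = _ , refl

Safe-put : ∀ {B a v C} → All Safe (branches B) → B ⇑[ put (nm a) v ] C →
           a ≡ out × ∃[ n ] v ≡ nm (ident n) × C ≡ done n
Safe-put safe (put b∈) with All.lookup safe b∈
... | announce = refl , _ , refl , refl

-- An action that matches an offer on a restricted channel has a variable as its subject.
quiet : ∀ {f : Contribution} {p k v} → Acts f p (get (ch k) v) ⊎ Acts f p (put (ch k) v) ⊎ f p ≡ nothing → Quiet (f p)
quiet (inj₁ (_ , eq , inᵃ ch _)) μ eq′ sub with trans (sym eq) eq′
quiet (inj₁ (_ , eq , inᵃ ch _)) μ eq′ () | refl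
quiet (inj₂ (inj₁ (_ , eq , outᵃ ch _))) μ eq′ sub with trans (sym eq) eq′
quiet (inj₂ (inj₁ (_ , eq , outᵃ ch _))) μ eq′ () | refl
quiet (inj₂ (inj₁ (_ , eq , boutᵃ ch))) μ eq′ sub with trans (sym eq) eq′
quiet (inj₂ (inj₁ (_ , eq , boutᵃ ch))) μ eq′ () | refl
quiet (inj₂ (inj₂ eq)) μ eq′ sub with trans (sym eq) eq′
... | ()

observe-step : ∀ {N N′ : Network 3} {Bs} → Represents (process N) Bs → Good Bs → (st : Step N N′) →
               ∃[ Cs ] Represents (process N′) Cs × Good Cs × (Bs ⟹ Cs) × Observed st Bs Cs
observe-step {Bs = Bs} (represents L↭ s) (good safe working next _) (step {μ} d) = outcome μ refl (sound d (λ _ → nm) s)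
  where
  outcome : ∀ μ′ → μ ≡ μ′ → Outcome nm _ Bs (contribution d) μ′ _ →
            ∃[ Cs ] Represents _ Cs × Good Cs × (Bs ⟹ Cs) × Observed (step d) Bs Cs
  -- Free names denote themselves and receptions are on restricted channels, so nothing is received
  -- from outside.
  outcome (inᵃ x y) eq (Cs , move {who = i} o _ _ _ , _) with Safe-get (safe i) o
  ... | _ , ()
  -- On a free name `Safe` lets only identifiers be sent, never a restricted channel.
  outcome (boutᵃ x y) eq (Cs , _ , _ , _ , _ , _ , move {who = i} o _ _ _ , _) with Safe-put (safe i) o
  ... | _ , _ , () , _
  outcome (outᵃ x y) refl (Cs , move {who = i} o refl (_ , eq , outᵃ nm nm) idle , s′) with Safe-put (safe i) o
  ... | refl , n , refl , refl =
    _ , represents L↭ s′ , next (announce o) , announce o , announces (offering o) refl eq idle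
  outcome τᵃ eq (Cs , L′ , L↭L′ , communication {who₁ = i} {j} i≢j o o′ refl a a′ idle , s′)
    with Safe-get (safe i) o
  ... | k , refl =
    _ , represents (↭-trans (↭-sym L↭L′) L↭) s′ , next (comm i≢j o o′) , comm i≢j o o′ ,
    internal (offering o) (offering o′) (proj₁ w) (proj₂ w) eq still
    where
    w = working i≢j o o′
    still : ∀ (l : Fin 4) → Quiet (contribution d (path l))
    still l with l Fin.≟ i | l Fin.≟ j
    ... | yes refl | _        = quiet {contribution d} {path l} (inj₁ a)
    ... | no _     | yes refl = quiet {contribution d} {path l} (inj₂ (inj₁ a′))
    ... | no l≢i   | no l≢j   = quiet {contribution d} {path l} {k} {nm out} (inj₂ (inj₂ (idle l l≢i l≢j)))

-- Trajectories and termination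

data Traj : ∀ {N N′ : Network 3} → Star Step N N′ → Vec Beh 4 → Vec Beh 4 → Set where
  ε   : ∀ {N Bs} → Traj (ε {x = N}) Bs Bs
  _◅_ : ∀ {N N′ N″ Bs Cs Ds} {st : Step N N′} {c : Star Step N′ N″} →
        Observed st Bs Cs → Traj c Cs Ds → Traj (st ◅ c) Bs Ds

_◅◅ᵗ_ : ∀ {N N′ N″ Bs Cs Ds} {c : Star Step N N′} {d : Star Step N′ N″} →
        Traj c Bs Cs → Traj d Cs Ds → Traj (c ◅◅ d) Bs Ds
ε        ◅◅ᵗ t′ = t′
(o ◅ t) ◅◅ᵗ t′ = o ◅ (t ◅◅ᵗ t′)

follow : ∀ {N N′ Bs} → Represents (process N) Bs → Good Bs → (c : Star Step N N′) →
         ∃[ Cs ] Represents (process N′) Cs × Good Cs × Traj c Bs Cs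
follow r g ε       = _ , r , g , ε
follow r g (s ◅ c) with observe-step r g s
... | _ , r′ , g′ , _ , o with follow r′ g′ c
... | _ , r″ , g″ , t = _ , r″ , g″ , o ◅ t

Finished : Network 3 → Vec Beh 4 → Set
Finished N Bs = Σ[ N′ ∈ Network 3 ] Σ[ c ∈ Star Step N N′ ] ∃[ Cs ]
  Represents (process N′) Cs × Good Cs × Traj c Bs Cs × Final Cs

-- Recursion on `Good`. The step from `progress` may realise another move than the one asked for, so
-- `observe-step` tells which move was made, and `next` at that move is the smaller proof.
finish : ∀ {N Bs} → Represents (process N) Bs → Good Bs → Finished N Bs
finish r g@(good _ _ _ (inj₁ fin)) = _ , ε , _ , r , g , ε , fin
finish r g@(good _ _ next (inj₂ (_ , t))) with progress r t
... | _ , s with observe-step r g s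
... | _ , r′ , _ , t′ , o with finish r′ (next t′)
... | _ , c , _ , r″ , g″ , u , fin = _ , s ◅ c , _ , r″ , g″ , o ◅ u , fin

no-infinite : ∀ {N Bs} → Represents (process N) Bs → Good Bs → Infinite N → ⊥
no-infinite r g@(good _ _ next _) I with observe-step r g (first I)
... | _ , r′ , _ , t , _ =
  no-infinite r′ (next t) record { state = state I ∘ suc ; first = rest I 0 ; rest = rest I ∘ suc }

final-stuck : ∀ {Bs Cs : Vec Beh 4} → Final Bs → ¬ (Bs ⟹ Cs)
final-stuck (n , all) (comm {i} _ o _) = offering o _ (all i)
final-stuck (n , all) (announce {i} o) = offering o _ (all i)

-- Announcements along a computation

Proj′ : ∀ {N : Network 3} → Computation N → List Side → ℕ → Maybe Action
Proj′ C p = observe (λ s → contribution (tree s) p) C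

Announcement : Maybe Action → Set
Announcement ma = ∃[ y ] ma ≡ just (outᵃ out y)

quiet⇒no-announcement : ∀ {ma} → Quiet ma → ¬ Announcement ma
quiet⇒no-announcement q (_ , eq) = q _ eq refl

nothing⇒no-announcement : ∀ {ma} → ma ≡ nothing → ¬ Announcement ma
nothing⇒no-announcement refl (_ , ())

other : ∀ {Bs : Vec Beh 4} {i k n} → Working (lookup Bs i) → lookup Bs k ≡ done n → k ≢ i
other w eq refl = w _ eq

done-stays : ∀ {N N′} {st : Step N N′} {Bs Cs k n} → Observed st Bs Cs → lookup Bs k ≡ done n →
             lookup Cs k ≡ done n × ¬ Announcement (contribution (tree st) (path k))
done-stays {Bs = Bs} {k = k} (internal {i} {j} {B} {C} wi wj _ _ _ q) eq =
  trans (lookup∘update′ (other {Bs} wj eq) (Bs [ i ]≔ B) C)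
        (trans (lookup∘update′ (other {Bs} wi eq) Bs B) eq) ,
  quiet⇒no-announcement (q k)
done-stays {Bs = Bs} {k = k} (announces wi _ _ idle) eq =
  trans (lookup∘update′ (other {Bs} wi eq) Bs _) eq , nothing⇒no-announcement (idle k (other {Bs} wi eq))

becomes-done : ∀ {N N′} {st : Step N N′} {Bs Cs} k → Observed st Bs Cs → Working (lookup Bs k) →
               (Working (lookup Cs k) × ¬ Announcement (contribution (tree st) (path k))) ⊎
               ∃[ n ] lookup Cs k ≡ done n × contribution (tree st) (path k) ≡ just (outᵃ out (ident n))
becomes-done {Bs = Bs} k (internal {i} {j} {B} {C} wi wj wB wC _ q) w =
  inj₁ (working , quiet⇒no-announcement (q k))
  where
  working : Working (lookup (Bs [ i ]≔ B [ j ]≔ C) k)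
  working with k Fin.≟ j
  ... | yes refl = subst Working (sym (lookup∘update j (Bs [ i ]≔ B) C)) wC
  ... | no k≢j with k Fin.≟ i
  ...   | yes refl = subst Working (sym (trans (lookup∘update′ k≢j (Bs [ i ]≔ B) C) (lookup∘update i Bs B))) wB
  ...   | no k≢i   = subst Working (sym (trans (lookup∘update′ k≢j (Bs [ i ]≔ B) C) (lookup∘update′ k≢i Bs B))) w
becomes-done {Bs = Bs} k (announces {i} {n} wi _ says idle) w with k Fin.≟ i
... | yes refl = inj₂ (n , lookup∘update i Bs (done n) , says)
... | no k≢i   = inj₁ (subst Working (sym (lookup∘update′ k≢i Bs (done n))) w ,
                       nothing⇒no-announcement (idle k k≢i))

never-again : ∀ {N N′ Bs Cs k n} {c : Star Step N N′} → Traj c Bs Cs → lookup Bs k ≡ done n →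
              lookup Cs k ≡ done n × (∀ l → ¬ Announcement (Proj′ (finite c) (path k) l))
never-again ε       eq = eq , λ { _ (_ , ()) }
never-again (o ◅ t) eq with done-stays o eq
... | eq′ , no-ann with never-again t eq′
... | eq″ , never = eq″ , λ { zero → no-ann ; (suc l) → never l }

-- There is a single moment at which component `k` stops working, and it is its announcement:
-- `becomes-done` excludes earlier ones, `never-again` later ones.
exactly-once : ∀ {N N′ Bs Cs} {c : Star Step N N′} k {n} → Traj c Bs Cs →
               Working (lookup Bs k) → lookup Cs k ≡ done n →
               ∃! _≡_ λ l → Proj′ (finite c) (path k) l ≡ just (outᵃ out (ident n))
exactly-once k ε       w eq = contradiction eq (w _)
exactly-once k (o ◅ t) w eq with becomes-done k o w
... | inj₁ (w′ , no-ann) with exactly-once k t w′ eq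
...   | l , says , unique = suc l , says ,
        λ { {zero} says′ → contradiction (_ , says′) no-ann ; {suc _} says′ → cong suc (unique says′) }
exactly-once k (o ◅ t) w eq | inj₂ (m , eq′ , says) with never-again {k = k} t eq′
... | eq″ , never with trans (sym eq″) eq
... | refl = zero , says , λ { {zero} _ → refl ; {suc l} says′ → contradiction (_ , says′) (never l) }

-- As `done n` persists, the last vector remembers every identifier announced so far; a unanimous
-- one therefore excludes a second leader.
labels-done : ∀ {N N′ Bs Cs y} {c : Star Step N N′} → Traj c Bs Cs → ∀ l →
              labels (finite c) l ≡ just (outᵃ out y) →
              ∃[ k ] ∃[ n ] y ≡ ident n × lookup Cs k ≡ done n
labels-done (o ◅ t) (suc l) eq = labels-done t l eq
labels-done (internal _ _ _ _ refl _ ◅ t) zero ()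
labels-done {Bs = Bs} (announces {i} {n} _ refl _ _ ◅ t) zero refl =
  i , n , refl , proj₁ (never-again {k = i} t (lookup∘update i Bs (done n)))

announcer-alone : ∀ {N N′ Bs Cs} {c : Star Step N N′} → Traj c Bs Cs → ∀ l {j k : Fin 4} {μ μ′} → j ≢ k →
                  Proj′ (finite c) (path j) l ≡ just μ → Proj′ (finite c) (path k) l ≡ just μ′ →
                  subject μ ≢ just out
announcer-alone (o ◅ t) (suc l) j≢k eq eq′ = announcer-alone t l j≢k eq eq′
announcer-alone (internal _ _ _ _ _ q ◅ t) zero {j} j≢k eq eq′ = q j _ eq
announcer-alone (announces {i} _ _ _ idle ◅ t) zero {j} {k} j≢k eq eq′ with j Fin.≟ i
... | no j≢i   = contradiction (trans (sym eq) (idle j j≢i)) λ ()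
... | yes refl = contradiction (trans (sym eq′) (idle k (j≢k ∘ sym))) λ ()

opposite-injective : ∀ {n} {i j : Fin n} → opposite i ≡ opposite j → i ≡ j
opposite-injective {i = i} {j} eq =
  trans (sym (Fin.opposite-involutive i)) (trans (cong opposite eq) (Fin.opposite-involutive j))

followedBy-finite : ∀ {N N′ N″ : Network 3} (c : Star Step N N′) (d : Star Step N′ N″) →
                    c followedBy finite d ≡ finite (c ◅◅ d)
followedBy-finite ε       d = refl
followedBy-finite (s ◅ c) d = cong (cons s) (followedBy-finite c d)

module _ {P : Network 3} {Bs : Vec Beh 4} (r : Represents (process P) Bs) (g : Good Bs) where

  outIsExternal : OutIsExternal P
  outIsExternal (infinite I) _ _ _ _ = contradiction I (no-infinite r g)
  outIsExternal (finite c) l {i} {j} i≢j eq eq′ with follow r g c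
  ... | _ , _ , _ , t = announcer-alone t l (i≢j ∘ opposite-injective)
          (subst (λ p → Proj′ (finite c) p l ≡ _) (sym (path-position i)) eq)
          (subst (λ p → Proj′ (finite c) p l ≡ _) (sym (path-position j)) eq′)

  -- Infinite computations do not exist, so a finite one is continued to a final vector, which
  -- determines the leader. A final vector has no moves, hence no step can be added.
  electoralSystem : (∀ k → Working (lookup Bs k)) → ElectoralSystem P
  electoralSystem w (infinite I) = contradiction I (no-infinite r g)
  electoralSystem w (finite c) with follow r g c
  ... | _ , r₁ , g₁ , t₁ with finish r₁ g₁
  ... | _ , d , Cs , r₂ , g₂ , t₂ , n , all =
    finite (c ◅◅ d) , subst (_Extends finite c) (followedBy-finite c d) (longer c (finite d)) ,
    n , elected , consistent
    where
    traj = t₁ ◅◅ᵗ t₂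
    elected : ∀ i → ∃! _≡_ λ l → Proj (finite (c ◅◅ d)) i l ≡ just (outᵃ out (ident (toℕ n)))
    elected i = subst (λ p → ∃! _≡_ λ l → Proj′ (finite (c ◅◅ d)) p l ≡ just (outᵃ out (ident (toℕ n))))
                      (path-position i) (exactly-once (opposite i) traj (w _) (all (opposite i)))
    done-label : ∀ {N′ Cs′} {e : Star Step P N′} → Traj e Bs Cs′ → (∀ k → lookup Cs′ k ≡ done (toℕ n)) →
                 ∀ l y → y ≢ ident (toℕ n) → labels (finite e) l ≢ just (outᵃ out y)
    done-label t all l y y≢ eq with labels-done t l eq
    ... | k , m , refl , eq′ with trans (sym (all k)) eq′
    ... | refl = y≢ refl
    consistent : ∀ C″ → C″ Extends finite (c ◅◅ d) → ∀ l y → y ≢ ident (toℕ n) →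
                 labels C″ l ≢ just (outᵃ out y)
    consistent _ itself = done-label traj all
    consistent _ (longer _ (finite ε)) l y y≢ eq =
      done-label (traj ◅◅ᵗ ε) all l y y≢
        (subst (λ C → labels C l ≡ _) (followedBy-finite (c ◅◅ d) ε) eq)
    consistent _ (longer _ (finite (s ◅ _))) with observe-step r₂ g₂ s
    ... | _ , _ , _ , t , _ = contradiction t (final-stuck (n , all))
    consistent _ (longer _ (infinite I)) = contradiction I (no-infinite r₂ g₂)

-- The protocol

-- De Bruijn terms.  The number in an input is the number of binder names skipped
-- before its own; it is chosen such that all binders are different.

data Term (n : ℕ) : Set
data Guard (n : ℕ) : Set

data Term n where
  choice   : List (Guard n) → Term n
  announce : Fin n → Term n

data Guard n where
  recv : Fin n → ℕ → Term (suc n) → Guard n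
  send : Fin n → Fin n → Term n → Guard n

-- On a value that is not an identifier the result is inactive; the search would reject such an
-- announcement as not `Safe`.
ended : Val → Beh
ended (nm (ident n)) = done n
ended _              = choice []

⟦_⟧ : ∀ {n} → Term n → Vec Val n → Beh
⟦_⟧* : ∀ {n} → List (Guard n) → Vec Val n → List Branch
⟦_⟧ᵍ : ∀ {n} → Guard n → Vec Val n → Branch

⟦ choice gs ⟧  η = choice (⟦ gs ⟧* η)
⟦ announce i ⟧ η = choice (send (nm out) (lookup η i) (ended (lookup η i)) ∷ [])

⟦ [] ⟧*     η = []
⟦ g ∷ gs ⟧* η = ⟦ g ⟧ᵍ η ∷ ⟦ gs ⟧* η

⟦ recv c _ t ⟧ᵍ η = recv (lookup η c) (λ v → ⟦ t ⟧ (v ∷ η))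
⟦ send c v t ⟧ᵍ η = send (lookup η c) (lookup η v) (⟦ t ⟧ η)

recv·_,_·_ : ∀ {n} → Fin n → ℕ → Term (suc n) → Term n
recv· c , d · t = choice (recv c d t ∷ [])

send·_,_·_ : ∀ {n} → Fin n → Fin n → Term n → Term n
send· c , v · t = choice (send c v t ∷ [])

-- `me` is the own identifier, k the channel of the first node that lost to this one,
-- c that of the second and l that of the third; u, v, o, y are the channels on which
-- other nodes may still be met.

leader : ∀ {n} (me k c l : Fin n) → Term n
leader me k c l = send· k , me · send· c , me · send· l , me · announce me

child : ∀ {n} → Fin n → ℕ → Term n
child c d = recv· c , d · announce zero

-- The leader answers each of the three messages, and a losing root has sent two of them: it takes
-- two answers before it informs the node on `k`.
lost : ∀ {n} (k c : Fin n) → ℕ → Term n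
lost k c d = recv· c , d · recv· suc c , 0 · send· suc (suc k) , zero · announce zero

-- The third message may come on the remaining channel `o` or on the channel `y` that arrived with
-- the second message.
last : ∀ {n} (me k c o y : Fin n) → Term n
last me k c o y = choice
  ( recv y 0 (leader (suc me) (suc k) (suc c) (suc y))
  ∷ recv o 1 (leader (suc me) (suc k) (suc c) (suc o))
  ∷ [])

-- The first message of a losing root carries the channel `v` on which the second will follow; the
-- second carries `u`, where a receiver that was initial before may still meet another node.
root : ∀ {n} (me k u v : Fin n) → Term n
root me k u v = choice
  ( recv u 0 (last (suc me) (suc k) (suc u) (suc v) zero)
  -- Each receiving branch has three binders, its own and two in `last`; hence `3` here and `6`
  -- below.
  ∷ recv v 3 (last (suc me) (suc k) (suc v) (suc u) zero)
  ∷ send v v (send· v , u · lost k v 6)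
  ∷ [])

initial : Term 3
initial = choice
  ( recv 0F 0 (root 3F 1F 2F 0F)
  -- A receiving branch has nine binders, its own and eight in `root`; two of them use the numbers
  -- up to 17.
  ∷ recv 1F 9 (root 3F 2F 1F 0F)
  ∷ send 0F 1F (child 0F 18)
  ∷ send 1F 0F (child 1F 19)
  ∷ [])

start : Vec Beh 4
-- From right to left, the order of behaviours in `Sem`.
start = f 3 2 ∷ f 2 1 ∷ f 1 0 ∷ f 0 3 ∷ []
  where
  f : ℕ → ℕ → Beh
  f i j = ⟦ initial ⟧ (ch i ∷ ch j ∷ nm (ident i) ∷ [])

-- No run has 40 steps.
good-start : Good start
good-start = from-just (check 40 start)

-- Translation of terms into processes

∑[_] : List (Prefix × Proc) → Proc
∑[ l ] = ∑ (proj₁ ∘ List.lookup l) (proj₂ ∘ List.lookup l)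

Sem-∑ : ∀ {ρ l B} → Pointwise (λ (α , P) → SemPrefixed ρ α P) l (branches B) → Sem ρ ∑[ l ] [] (B ∷ [])
Sem-∑ s = sum (Perm.cast-id (Pointwise-length s)) (lookup⁺ s)

∈-∑[] : ∀ {l α P a} → (α , P) ∈ l → a ∈ fnPrefixed α (fn P) → a ∈ fn ∑[ l ]
∈-∑[] {(α , P) ∷ l} (here refl) a∈ = ∈-++⁺ˡ a∈
∈-∑[] {(α , P) ∷ l} (there αP∈) a∈ = ∈-++⁺ʳ (fnPrefixed α (fn P)) (∈-∑[] αP∈ a∈)

-- Certificates that a name in scope really occurs. Together with `fn-compile` they determine the
-- free names of the agents, and thereby the edges and their types.
data Mentions {n} (i : Fin n) : Term n → Set where
  recv    : ∀ {c d t gs} → recv c d t ∈ gs → Mentions (suc i) t → Mentions i (choice gs)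
  channel : ∀ {v t gs} → send i v t ∈ gs → Mentions i (choice gs)
  value   : ∀ {c t gs} → send c i t ∈ gs → Mentions i (choice gs)

initial-mentions : ∀ i → Mentions i initial
initial-mentions 0F = channel (there (there (here refl)))
initial-mentions 1F = value (there (there (here refl)))
-- Below three inputs, the new leader sends its identifier.
initial-mentions 2F = recv (here refl) (recv (here refl) (recv (here refl) (value (here refl))))

module Compile (base : ℕ) where

  compile  : ∀ {n} → ℕ → Term n → Vec Name n → Proc
  compile* : ∀ {n} → ℕ → List (Guard n) → Vec Name n → List (Prefix × Proc)
  compileᵍ : ∀ {n} → ℕ → Guard n → Vec Name n → Prefix × Proc

  compile k (choice gs)  η = ∑[ compile* k gs η ]
  compile k (announce i) η = ∑[ (out ⟨ lookup η i ⟩ᵒ , ∑[ [] ]) ∷ [] ]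

  compile* k []       η = []
  compile* k (g ∷ gs) η = compileᵍ k g η ∷ compile* k gs η

  compileᵍ k (recv c d t) η = lookup η c ⟨ base + (k + d) ⟩ⁱ ,
                              compile (suc (k + d)) t (var (base + (k + d)) ∷ η)
  compileᵍ k (send c v t) η = lookup η c ⟨ lookup η v ⟩ᵒ , compile k t η

  -- The numbers from `k` on are reserved for binders still to come, which therefore capture nothing
  -- in scope.
  Unused : ℕ → ∀ {n} → Vec Name n → Set
  Unused k η = ∀ i m → k ≤ m → lookup η i ≢ var (base + m)

  Unused-∷ : ∀ {k n} {η : Vec Name n} d → Unused k η → Unused (suc (k + d)) (var (base + (k + d)) ∷ η)
  Unused-∷ {k} d unused zero    m k< eq =
    ℕ.<⇒≢ k< (ℕ.+-cancelˡ-≡ base (k + d) m (var-injective eq))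
  Unused-∷ {k} d unused (suc i) m k< eq = unused i m (ℕ.≤-trans (ℕ.m≤m+n k d) (ℕ.<⇒≤ k<)) eq

  Agrees : Env → ∀ {n} → Vec Name n → Vec Val n → Set
  Agrees ρ η vs = ∀ i → ρ (lookup η i) ≡ lookup vs i

  Agrees-∷ : ∀ {k ρ v n} {η : Vec Name n} {vs} d → Unused k η → Agrees ρ η vs →
             Agrees (ρ [ base + (k + d) ≔ v ]) (var (base + (k + d)) ∷ η) (v ∷ vs)
  Agrees-∷ {k} {ρ} {v} d unused h zero    = ≔-same ρ _ v
  Agrees-∷ {k} {ρ} {v} d unused h (suc i) =
    trans (≔-other ρ v (unused i (k + d) (ℕ.m≤m+n k d))) (h i)

  Sem-compile  : ∀ {n ρ k} (t : Term n) {η vs} → ρ out ≡ nm out → Unused k η → Agrees ρ η vs →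
                 Sem ρ (compile k t η) [] (⟦ t ⟧ vs ∷ [])
  Sem-compile* : ∀ {n ρ k} (gs : List (Guard n)) {η vs} → ρ out ≡ nm out → Unused k η → Agrees ρ η vs →
                 Pointwise (λ (α , P) → SemPrefixed ρ α P) (compile* k gs η) (⟦ gs ⟧* vs)
  Sem-compileᵍ : ∀ {n ρ k} (g : Guard n) {η vs} → ρ out ≡ nm out → Unused k η → Agrees ρ η vs →
                 SemPrefixed ρ (proj₁ (compileᵍ k g η)) (proj₂ (compileᵍ k g η)) (⟦ g ⟧ᵍ vs)

  Sem-compile (choice gs) o u h = Sem-∑ (Sem-compile* gs o u h)
  Sem-compile {ρ = ρ} (announce i) {vs = vs} o u h =
    Sem-∑ (send o (h i) (Sem-∑ (ended-empty (lookup vs i))) ∷ [])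
    where
    ended-empty : ∀ v → Pointwise (λ (α , P) → SemPrefixed ρ α P) [] (branches (ended v))
    ended-empty (nm (ident _)) = []
    ended-empty (nm out)       = []
    ended-empty (nm (var _))   = []
    ended-empty (ch _)         = []

  Sem-compile* []       o u h = []
  Sem-compile* (g ∷ gs) o u h = Sem-compileᵍ g o u h ∷ Sem-compile* gs o u h

  Sem-compileᵍ {ρ = ρ} {k} (recv c d t) o u h =
    recv (h c) λ v → Sem-compile t (trans (≔-other ρ {base + (k + d)} {out} v λ ()) o)
                               (Unused-∷ d u) (Agrees-∷ {ρ = ρ} d u h)
  Sem-compileᵍ (send c v t) o u h = send (h c) (h v) (Sem-compile t o u h)

  InScope : Name → ∀ {n} → Vec Name n → Set
  InScope a η = a ≡ out ⊎ ∃[ i ] a ≡ lookup η i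

  fn-compile  : ∀ {n k} (t : Term n) {η a} → a ∈ fn (compile k t η) → InScope a η
  fn-compile* : ∀ {n k} (gs : List (Guard n)) {η a} → a ∈ fn ∑[ compile* k gs η ] → InScope a η
  fn-compileᵍ : ∀ {n k} (g : Guard n) {η a} →
                a ∈ fnPrefixed (proj₁ (compileᵍ k g η)) (fn (proj₂ (compileᵍ k g η))) → InScope a η

  fn-compile (choice gs)  a∈                  = fn-compile* gs a∈
  fn-compile (announce i) (here refl)         = inj₁ refl
  fn-compile (announce i) (there (here refl)) = inj₂ (i , refl)

  fn-compile* {k = k} (g ∷ gs) {η} a∈
    with ∈-++⁻ (fnPrefixed (proj₁ (compileᵍ k g η)) (fn (proj₂ (compileᵍ k g η)))) a∈
  ... | inj₁ a∈₁ = fn-compileᵍ g a∈₁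
  ... | inj₂ a∈₂ = fn-compile* gs a∈₂

  fn-compileᵍ (recv c d t) (here refl) = inj₂ (c , refl)
  fn-compileᵍ {k = k} (recv c d t) {η} (there a∈)
    with ∈-remove⁻ (fn (compile (suc (k + d)) t (var (base + (k + d)) ∷ η))) a∈
  ... | a∈t , a≢ with fn-compile t a∈t
  ... | inj₁ eq           = inj₁ eq
  ... | inj₂ (zero , eq)  = contradiction eq a≢
  ... | inj₂ (suc i , eq) = inj₂ (i , eq)
  fn-compileᵍ (send c v t) (here refl)         = inj₂ (c , refl)
  fn-compileᵍ (send c v t) (there (here refl)) = inj₂ (v , refl)
  fn-compileᵍ (send c v t) (there (there a∈))  = fn-compile t a∈

  ∈-compile* : ∀ {n k g} {gs : List (Guard n)} {η} → g ∈ gs → compileᵍ k g η ∈ compile* k gs η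
  ∈-compile* (here refl) = here refl
  ∈-compile* (there g∈)  = there (∈-compile* g∈)

  fn-compile⁺ : ∀ {n k i} {t : Term n} {η} → Mentions i t → Unused k η → lookup η i ∈ fn (compile k t η)
  fn-compile⁺ {k = k} {i} {η = η} (recv {d = d} g∈ m) u =
    ∈-∑[] (∈-compile* {k = k} {η = η} g∈)
          (there (∈-remove (fn-compile⁺ m (Unused-∷ d u)) (u i (k + d) (ℕ.m≤m+n k d))))
  fn-compile⁺ {k = k} {η = η} (channel g∈) u = ∈-∑[] (∈-compile* {k = k} {η = η} g∈) (here refl)
  fn-compile⁺ {k = k} {η = η} (value g∈)   u = ∈-∑[] (∈-compile* {k = k} {η = η} g∈) (there (here refl))

-- The network on the square

prev : Fin 4 → Fin 4
prev 0F = 3F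
prev 1F = 0F
prev 2F = 1F
prev 3F = 2F

i≢prev : ∀ i → i ≢ prev i
i≢prev 0F ()
i≢prev 1F ()
i≢prev 2F ()
i≢prev 3F ()

-- Exchanging the channels exchanges the two inputs of `initial` and its two outputs, and the order
-- of summands is immaterial. This serves the automorphisms that reverse the orientation of the
-- square.
Sem-swap : ∀ {ρ P u v w} → Sem ρ P [] (⟦ initial ⟧ (u ∷ v ∷ w ∷ []) ∷ []) →
           Sem ρ P [] (⟦ initial ⟧ (v ∷ u ∷ w ∷ []) ∷ [])
Sem-swap {ρ} {u = u} {v} {w} (sum {α = α} {P} π s) = sum (π Perm.∘ₚ swap) λ i →
  subst (SemPrefixed ρ (α i) (P i)) (swapped (π Perm.⟨$⟩ʳ i)) (s i)
  where
  swap : Perm.Permutation′ 4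
  swap = Perm.transpose 0F 1F Perm.∘ₚ Perm.transpose 2F 3F
  swapped : ∀ j → List.lookup (branches (⟦ initial ⟧ (u ∷ v ∷ w ∷ []))) j ≡
                  List.lookup (branches (⟦ initial ⟧ (v ∷ u ∷ w ∷ []))) (swap Perm.⟨$⟩ʳ j)
  swapped 0F = refl
  swapped 1F = refl
  swapped 2F = refl
  swapped 3F = refl

module Square (x : Fin 4 → Var) (x-injective : Injective _≡_ _≡_ x) (base : ℕ) (x<base : ∀ i → x i < base) where

  open Compile base public

  scope : Fin 4 → Vec Name 3
  scope i = var (x i) ∷ var (x (prev i)) ∷ ident (toℕ i) ∷ []

  scope-unused : ∀ i k → Unused k (scope i)
  scope-unused i k 0F m _ eq = ℕ.<⇒≱ (x<base i) (subst (base ≤_) (sym (var-injective eq)) (ℕ.m≤m+n base m))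
  scope-unused i k 1F m _ eq = ℕ.<⇒≱ (x<base (prev i)) (subst (base ≤_) (sym (var-injective eq)) (ℕ.m≤m+n base m))
  scope-unused i k 2F m _ ()

  data Free (i : Fin 4) : Name → Set where
    out     : Free i out
    channel : ∀ {e} → e ≡ i ⊎ e ≡ prev i → Free i (var (x e))
    ident   : Free i (ident (toℕ i))

  inScope⇒Free : ∀ {i a} → InScope a (scope i) → Free i a
  inScope⇒Free (inj₁ refl)        = out
  inScope⇒Free (inj₂ (0F , refl)) = channel (inj₁ refl)
  inScope⇒Free (inj₂ (1F , refl)) = channel (inj₂ refl)
  inScope⇒Free (inj₂ (2F , refl)) = ident

  abstract
    agent : Fin 4 → Proc
    -- `initial` has 20 binders, so the four agents use consecutive blocks of names from `base` on.
    agent i = compile (20 * toℕ i) initial (scope i)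

    Sem-agent : ∀ {ρ i} vs → ρ out ≡ nm out → Agrees ρ (scope i) vs → Sem ρ (agent i) [] (⟦ initial ⟧ vs ∷ [])
    Sem-agent {i = i} vs o h = Sem-compile {k = 20 * toℕ i} initial {scope i} {vs} o (scope-unused i _) h

    fn-agent : ∀ {i a} → a ∈ fn (agent i) → Free i a
    fn-agent {i} a∈ = inScope⇒Free (fn-compile {k = 20 * toℕ i} initial {scope i} a∈)

    mentioned∈agent : ∀ i j → lookup (scope i) j ∈ fn (agent i)
    mentioned∈agent i j =
      fn-compile⁺ {k = 20 * toℕ i} {t = initial} {scope i} (initial-mentions j) (scope-unused i _)

    bound-agents : concat (List.map bound (Vec.toList (Vec.tabulate agent))) ≡ List.map (base +_) (upTo 80)
    bound-agents = refl

  channel∈agent : ∀ {i e} → e ≡ i ⊎ e ≡ prev i → var (x e) ∈ fn (agent i)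
  channel∈agent {i} (inj₁ refl) = mentioned∈agent i 0F
  channel∈agent {i} (inj₂ refl) = mentioned∈agent i 1F

  ident∈agent : ∀ i → ident (toℕ i) ∈ fn (agent i)
  ident∈agent i = mentioned∈agent i 2F

  private
    agents : Vec Proc 4
    agents = Vec.tabulate agent

    offsets-unique : ∀ n → Unique (List.map (base +_) (upTo n))
    offsets-unique n = Unique.map⁺ (ℕ.+-cancelˡ-≡ base _ _) (Unique.upTo⁺ n)

    base≤ : ∀ {y} ms → y ∈ List.map (base +_) ms → base ≤ y
    base≤ ms y∈ with ∈-map⁻ (base +_) {xs = ms} y∈
    ... | m , _ , refl = ℕ.m≤m+n base m

    base≤bound : ∀ {y} → y ∈ concat (List.map bound (Vec.toList agents)) → base ≤ y
    base≤bound {y} y∈ = base≤ (upTo 80) (subst (y ∈_) bound-agents y∈)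

  fn-body⁻ : ∀ {a} → a ∈ fn (Vec.foldl₁ _∣_ agents) → ∃[ i ] a ∈ fn (agent i)
  fn-body⁻ = ∈-fn₄ agent

  square-network : Network 3
  square-network .restricted = List.tabulate x
  square-network .Network.components = agents
  square-network .Network.bound-distinct =
    Unique.++⁺ (Unique.tabulate⁺ x-injective)
      (subst Unique (sym bound-agents) (offsets-unique 80))
      λ (y∈ , y∈′) → disjoint y∈ y∈′
    where
    disjoint : ∀ {y} → y ∈ List.tabulate x → y ∉ concat (List.map bound (Vec.toList agents))
    disjoint y∈ y∈′ with ∈-tabulate⁻ {f = x} y∈
    ... | i , refl = ℕ.<⇒≱ (x<base i) (base≤bound y∈′)
  square-network .Network.bound-not-free y∈ y∈fn with fn-body⁻ y∈fn
  ... | i , y∈i with fn-agent y∈i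
  ... | channel {e} _ = ℕ.<⇒≱ (x<base e) (base≤bound y∈)

  fn-body⁺ : ∀ {a} i → a ∈ fn (agent i) → a ∈ fn (Network.body square-network)
  fn-body⁺ 0F a∈ = ∈-++⁺ˡ (∈-++⁺ˡ (∈-++⁺ˡ a∈))
  fn-body⁺ 1F a∈ = ∈-++⁺ˡ (∈-++⁺ˡ (∈-++⁺ʳ (fn (agent 0F)) a∈))
  fn-body⁺ 2F a∈ = ∈-++⁺ˡ (∈-++⁺ʳ (fn (agent 0F ∣ agent 1F)) a∈)
  fn-body⁺ 3F a∈ = ∈-++⁺ʳ (fn (agent 0F ∣ agent 1F ∣ agent 2F)) a∈

  initially : Represents (process square-network) start
  initially = represents ↭-refl (res (res (res (res (par (par (par
    (Sem-component 0F) (Sem-component 1F)) (Sem-component 2F)) (Sem-component 3F))))))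
    where
    x≢ : ∀ {i j} → i ≢ j → var (x i) ≢ var (x j)
    x≢ i≢j = i≢j ∘ x-injective ∘ var-injective
    ρ₀ ρ₁ ρ₂ ρ : Env
    ρ₀ = nm [ x 0F ≔ ch 0 ]
    ρ₁ = ρ₀ [ x 1F ≔ ch 1 ]
    ρ₂ = ρ₁ [ x 2F ≔ ch 2 ]
    ρ  = ρ₂ [ x 3F ≔ ch 3 ]
    ρ-channel : ∀ i → ρ (var (x i)) ≡ ch (toℕ i)
    ρ-channel 3F = ≔-same ρ₂ (x 3F) _
    ρ-channel 2F = trans (≔-other ρ₂ _ (x≢ λ ())) (≔-same ρ₁ (x 2F) _)
    ρ-channel 1F = trans (≔-other ρ₂ _ (x≢ λ ())) (trans (≔-other ρ₁ _ (x≢ λ ())) (≔-same ρ₀ (x 1F) _))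
    ρ-channel 0F = trans (≔-other ρ₂ _ (x≢ λ ())) (trans (≔-other ρ₁ _ (x≢ λ ()))
                     (trans (≔-other ρ₀ _ (x≢ λ ())) (≔-same nm (x 0F) _)))
    values : Fin 4 → Vec Val 3
    values i = ch (toℕ i) ∷ ch (toℕ (prev i)) ∷ nm (ident (toℕ i)) ∷ []
    Sem-component : ∀ i → Sem ρ (agent i) [] (⟦ initial ⟧ (values i) ∷ [])
    Sem-component i = Sem-agent (values i) refl λ { 0F → ρ-channel i ; 1F → ρ-channel (prev i) ; 2F → refl }

-- Hypergraph, symmetry and automorphisms

module _ (x : Fin 4 → Var) where

  side-lookup : ∀ e i → lookup (side x e) i ≡ does ((e Fin.≟ i) ⊎-dec (e Fin.≟ prev i))
  side-lookup 0F = λ { 0F → refl ; 1F → refl ; 2F → refl ; 3F → refl }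
  side-lookup 1F = λ { 0F → refl ; 1F → refl ; 2F → refl ; 3F → refl }
  side-lookup 2F = λ { 0F → refl ; 1F → refl ; 2F → refl ; 3F → refl }
  side-lookup 3F = λ { 0F → refl ; 1F → refl ; 2F → refl ; 3F → refl }

  typeAmong-side : Injective _≡_ _≡_ x → ∀ is {e} → e ∈ is → typeAmong x is (var (x e)) ≡ side x e
  typeAmong-side inj (i ∷ is) {e} e∈ with e Fin.≟ i
  ... | yes refl = if-same (x e)
  ... | no e≢i   with e∈
  ...   | here e≡i  = contradiction e≡i e≢i
  ...   | there e∈′ = trans (if-other (e≢i ∘ inj ∘ var-injective)) (typeAmong-side inj is e∈′)

onIdents : (Fin 4 → Fin 4) → ℕ → ℕ
onIdents f 0 = toℕ (f 0F)
onIdents f 1 = toℕ (f 1F)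
onIdents f 2 = toℕ (f 2F)
onIdents f 3 = toℕ (f 3F)
onIdents f n = n

onIdents-toℕ : ∀ f i → onIdents f (toℕ i) ≡ toℕ (f i)
onIdents-toℕ f 0F = refl
onIdents-toℕ f 1F = refl
onIdents-toℕ f 2F = refl
onIdents-toℕ f 3F = refl

module SquareHypergraph (x : Fin 4 → Var) (x-injective : Injective _≡_ _≡_ x)
                        (base : ℕ) (x<base : ∀ i → x i < base) where

  open Square x x-injective base x<base

  private
    N : Network 3
    N = square-network
    H : Hypergraph 4
    H = hypergraph N

  data Edge : Name → Set where
    channel : ∀ e → Edge (var (x e))
    ident   : ∀ (i : Fin 4) → Edge (ident (toℕ i))

  edge : ∀ {a} → a ∈ edges H → Edge a
  edge a∈ with ∈-filter⁻ (λ a → ¬? (a ≟ out)) {xs = fn (Network.body N)} a∈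
  ... | a∈fn , a≢out with fn-body⁻ a∈fn
  ... | i , a∈i with fn-agent a∈i
  ... | out           = contradiction refl a≢out
  ... | channel {e} _ = channel e
  ... | ident         = ident i

  ∈-edges : ∀ {a} i → a ∈ fn (agent i) → a ≢ out → a ∈ edges H
  ∈-edges i a∈ a≢out = ∈-filter⁺ (λ a → ¬? (a ≟ out)) (fn-body⁺ i a∈) a≢out

  edge⁻ : ∀ {a} → Edge a → a ∈ edges H
  edge⁻ (channel e) = ∈-edges e (channel∈agent (inj₁ refl)) λ ()
  edge⁻ (ident i)   = ∈-edges i (ident∈agent i) λ ()

  component≡agent : ∀ i → component N i ≡ agent i
  component≡agent = lookup∘tabulate agent

  lookup-t : ∀ a i → lookup (t H a) i ≡ does (a ∈? fn (component N i))
  lookup-t a i = lookup∘tabulate (λ n → does (a ∈? fn (component N n))) i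

  ∈-t⁺ : ∀ {a i} → a ∈ fn (agent i) → i ∈ˢ t H a
  ∈-t⁺ {a} {i} a∈ = lookup⇒[]= i (t H a) (trans (lookup-t a i)
    (dec-true (a ∈? fn (component N i)) (subst (λ P → a ∈ fn P) (sym (component≡agent i)) a∈)))

  ∈-t⁻ : ∀ {a i} → i ∈ˢ t H a → a ∈ fn (agent i)
  ∈-t⁻ {a} {i} i∈ with a ∈? fn (component N i) | trans (sym (lookup-t a i)) ([]=⇒lookup i∈)
  ... | yes a∈ | _  = subst (λ P → a ∈ fn P) (component≡agent i) a∈

  channel-ends : ∀ {e i} → var (x e) ∈ fn (agent i) → e ≡ i ⊎ e ≡ prev i
  channel-ends a∈ = ends (fn-agent a∈) refl
    where
    ends : ∀ {a e i} → Free i a → a ≡ var (x e) → e ≡ i ⊎ e ≡ prev i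
    ends (channel {e′} e′≡) eq with x-injective (var-injective eq)
    ... | refl = e′≡

  ident-owner : ∀ {m i} → ident m ∈ fn (agent i) → m ≡ toℕ i
  ident-owner a∈ with fn-agent a∈
  ... | ident = refl

  t-channel : ∀ e → t H (var (x e)) ≡ t (square x) (var (x e))
  t-channel e = trans (sym (tabulate∘lookup (t H (var (x e))))) (trans (tabulate-cong pointwise)
    (trans (tabulate∘lookup (side x e)) (sym (typeAmong-side x x-injective (allFin 4) (∈-allFin e)))))
    where
    pointwise : ∀ i → lookup (t H (var (x e))) i ≡ lookup (side x e) i
    pointwise i = trans (lookup-t (var (x e)) i) (trans
      (does-⇔ (mk⇔ (λ a∈ → channel-ends (subst (λ P → var (x e) ∈ fn P) (component≡agent i) a∈))
                   (λ ends → subst (λ P → var (x e) ∈ fn P) (sym (component≡agent i)) (channel∈agent ends)))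
              (var (x e) ∈? fn (component N i)) ((e Fin.≟ i) ⊎-dec (e Fin.≟ prev i)))
      (sym (side-lookup x e i)))

  module _ (σ : AutomorphismOn N) where

    private
      p : Fin 4 → Fin 4
      p i = σN (automorphism σ) ⟨$⟩ʳ i

      f : Name → Name
      f = rename σ

    f-edge : ∀ {e} → f (var (x e)) ≡ σX (automorphism σ) (var (x e))
    f-edge {e} = cong (if_then σX (automorphism σ) (var (x e)) else var (x e))
                      (dec-true (var (x e) ∈? edges H) (edge⁻ (channel e)))

    f-out : f out ≡ out
    f-out = cong (if_then σX (automorphism σ) out else out) (dec-false (out ∈? edges H) (out-no-edge ∘ edge))
      where
      out-no-edge : ¬ Edge out
      out-no-edge ()

    f-ident : ∀ i → f (ident (toℕ i)) ≡ ident (toℕ (p i))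
    f-ident 0F = refl
    f-ident 1F = refl
    f-ident 2F = refl
    f-ident 3F = refl

    -- Restricted names go to restricted names, so a channel goes to a channel, and preservation of
    -- types carries incidence with `i` to incidence with `p i`.
    image : ∀ i {e} → e ≡ i ⊎ e ≡ prev i → ∃[ e′ ] f (var (x e)) ≡ var (x e′) × (e′ ≡ p i ⊎ e′ ≡ prev (p i))
    image i {e} e≡
      with ∈-map⁻ var (Equivalence.to (restricted-agree σ (edge⁻ (channel e)))
                                      (∈-map⁺ var (∈-tabulate⁺ {f = x} e)))
    ... | y , y∈ , eq with ∈-tabulate⁻ {f = x} y∈
    ... | e′ , refl = e′ , trans f-edge eq ,
      channel-ends (∈-t⁻ (subst (λ a → p i ∈ˢ t H a) eq
        (Equivalence.from (types (automorphism σ) (edge⁻ (channel e)) (p i)) (i , ∈-t⁺ (channel∈agent e≡) , refl))))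

    f-injective : ∀ {e e′} → f (var (x e)) ≡ f (var (x e′)) → e ≡ e′
    f-injective {e} {e′} eq = x-injective (var-injective
      (trans (sym (inverseˡ (automorphism σ) (edge⁻ (channel e))))
        (trans (cong (σX⁻¹ (automorphism σ)) (trans (sym f-edge) (trans eq f-edge)))
               (inverseˡ (automorphism σ) (edge⁻ (channel e′))))))

    -- The two channels at `i` have different images, hence go onto the two channels at `p i`, in
    -- the same or the opposite order; `Sem-swap` absorbs the opposite order.
    Sem-image : ∀ i → Sem (nm ∘ f) (agent i) [] (⟦ initial ⟧ (Vec.map nm (scope (p i))) ∷ [])
    Sem-image i with image i (inj₁ refl) | image i (inj₂ refl)
    ... | a , fa , inj₁ refl | b , fb , inj₂ refl =
      Sem-agent (Vec.map nm (scope (p i))) (cong nm f-out)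
        λ { 0F → cong nm fa ; 1F → cong nm fb ; 2F → cong nm (f-ident i) }
    ... | a , fa , inj₂ refl | b , fb , inj₁ refl =
      Sem-swap (Sem-agent (nm (var (x (prev (p i)))) ∷ nm (var (x (p i))) ∷ nm (ident (toℕ (p i))) ∷ [])
        (cong nm f-out) λ { 0F → cong nm fa ; 1F → cong nm fb ; 2F → cong nm (f-ident i) })
    ... | a , fa , inj₁ refl | b , fb , inj₁ refl = contradiction (f-injective (trans fa (sym fb))) (i≢prev i)
    ... | a , fa , inj₂ refl | b , fb , inj₂ refl = contradiction (f-injective (trans fa (sym fb))) (i≢prev i)

    captured : ∀ {i a} → a ∈ fn (agent i) → f a ∈ edges H ++ fn (agent i)
    captured {i} a∈ with fn-agent a∈
    ... | out           = ∈-++⁺ʳ (edges H) (subst (_∈ fn (agent i)) (sym f-out) a∈)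
    ... | channel {e} _ = ∈-++⁺ˡ (subst (_∈ edges H) (sym f-edge) (σX-edge (automorphism σ) (edge⁻ (channel e))))
    ... | ident         = ∈-++⁺ˡ (subst (_∈ edges H) (sym (f-ident i)) (edge⁻ (ident (p i))))

    symmetricWrt : SymmetricWrt σ
    symmetricWrt i rewrite component≡agent i | component≡agent (p i) =
      -- Both sides have the behaviour of the agent at `p i`. The bound 0 is right for `nm`, whose
      -- values include no channel.
      Sem⇒≈ {K = 0} (Injective⇒Reflects nm-injective) (λ _ ()) (λ _ ())
        (Sem-agent (Vec.map nm (scope (p i))) refl λ { 0F → refl ; 1F → refl ; 2F → refl })
        (Sem-ren {σ = nm ∘ f} (λ _ → refl) captured (Sem-image i))

  idents : List Name
  idents = map (ident ∘ toℕ) (allFin 4)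

  square-edge : ∀ {a} → a ∈ edges (square x) → ∃[ e ] a ≡ var (x e)
  square-edge a∈ with ∈-map⁻ (var ∘ x) a∈
  ... | e , _ , eq = e , eq

  square-edge⁻ : ∀ e → var (x e) ∈ edges (square x)
  square-edge⁻ e = ∈-map⁺ (var ∘ x) (∈-allFin e)

  same-hypergraph : SameHypergraph (withoutIdentifiers H) (square x)
  same-hypergraph = record
    { same-edges = λ a → mk⇔ to from
    ; same-types = λ a∈ → same-type (square-edge (to a∈))
    }
    where
    var∉idents : ∀ {y} → var y ∉ idents
    var∉idents y∈ with ∈-map⁻ (ident ∘ toℕ) {xs = allFin 4} y∈
    ... | _ , _ , ()
    to : ∀ {a} → a ∈ edges (withoutIdentifiers H) → a ∈ edges (square x)
    to a∈ with ∈-filter⁻ (_∉? idents) {xs = edges H} a∈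
    ... | a∈H , a∉ with edge a∈H
    ... | channel e = square-edge⁻ e
    ... | ident i   = contradiction (∈-map⁺ (ident ∘ toℕ) (∈-allFin i)) a∉
    from : ∀ {a} → a ∈ edges (square x) → a ∈ edges (withoutIdentifiers H)
    from a∈ with square-edge a∈
    ... | e , refl = ∈-filter⁺ (_∉? idents) (edge⁻ (channel e)) var∉idents
    same-type : ∀ {a} → ∃[ e ] a ≡ var (x e) → t H a ≡ t (square x) a
    same-type (e , refl) = t-channel e

  module _ (ρ : Automorphism (square x)) where

    private
      p q : Fin 4 → Fin 4
      p i = σN ρ ⟨$⟩ʳ i
      q i = σN ρ ⟨$⟩ˡ i

    -- Identifiers must follow the nodes that they denote, while channels follow the automorphism of
    -- the square.
    extendBy : (Name → Name) → (Fin 4 → Fin 4) → Name → Name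
    extendBy g h (ident n) = ident (onIdents h n)
    extendBy g h out       = out
    extendBy g h (var y)   = g (var y)

    extendBy-square : ∀ {g h a} → a ∈ edges (square x) → extendBy g h a ≡ g a
    extendBy-square a∈ with square-edge a∈
    ... | _ , refl = refl

    extendBy-ident : ∀ g h i → extendBy g h (ident (toℕ i)) ≡ ident (toℕ (h i))
    extendBy-ident g h i = cong ident (onIdents-toℕ h i)

    extendBy-edge : ∀ {g h a} → (∀ {b} → b ∈ edges (square x) → g b ∈ edges (square x)) →
                    Edge a → extendBy g h a ∈ edges H
    extendBy-edge g-edge (channel e) with square-edge (g-edge (square-edge⁻ e))
    ... | e′ , eq = subst (_∈ edges H) (sym eq) (edge⁻ (channel e′))
    extendBy-edge {g} {h} g-edge (ident i) = subst (_∈ edges H) (sym (extendBy-ident g h i)) (edge⁻ (ident (h i)))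

    extendBy-inverse : ∀ {g h g′ h′ a} → (∀ {b} → b ∈ edges (square x) → g b ∈ edges (square x)) →
                       (∀ {b} → b ∈ edges (square x) → g′ (g b) ≡ b) → (∀ i → h′ (h i) ≡ i) →
                       Edge a → extendBy g′ h′ (extendBy g h a) ≡ a
    extendBy-inverse {g} {h} {g′} {h′} g-edge inv _ (channel e) =
      trans (extendBy-square {g′} {h′} (g-edge (square-edge⁻ e))) (inv (square-edge⁻ e))
    extendBy-inverse {g} {h} {g′} {h′} _ _ inv (ident i) =
      trans (cong (extendBy g′ h′) (extendBy-ident g h i))
            (trans (extendBy-ident g′ h′ (h i)) (cong (ident ∘ toℕ) (inv i)))

    σ₊ : Name → Name
    σ₊ = extendBy (σX ρ) p

    σ₊-types : ∀ {a} → Edge a → ∀ j → j ∈ˢ t H (σ₊ a) ⇔ (∃[ i ] (i ∈ˢ t H a × p i ≡ j))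
    σ₊-types (channel e) j with square-edge (σX-edge ρ (square-edge⁻ e))
    ... | e′ , eq = subst₂ (λ T T′ → (j ∈ˢ T) ⇔ (∃[ i ] (i ∈ˢ T′ × p i ≡ j)))
      (trans (cong (t (square x)) eq) (trans (sym (t-channel e′)) (cong (t H) (sym eq))))
      (sym (t-channel e)) (types ρ (square-edge⁻ e) j)
    -- The type of an identifier is the singleton of its owner.
    σ₊-types (ident i) j rewrite extendBy-ident (σX ρ) p i = mk⇔
      (λ j∈ → i , ∈-t⁺ (ident∈agent i) , Fin.toℕ-injective (ident-owner (∈-t⁻ j∈)))
      λ (i′ , i′∈ , eq) → ∈-t⁺ (subst (λ k → ident (toℕ k) ∈ fn (agent j))
        (trans (sym eq) (cong p (sym (Fin.toℕ-injective (ident-owner (∈-t⁻ i′∈)))))) (ident∈agent j))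

    σ₊-restricted : ∀ {a} → Edge a → (a ∈ map var (List.tabulate x)) ⇔ (σ₊ a ∈ map var (List.tabulate x))
    σ₊-restricted (channel e) = mk⇔
      (λ _ → subst (_∈ _) (sym (proj₂ image′)) (∈-map⁺ var (∈-tabulate⁺ {f = x} (proj₁ image′))))
      (λ _ → ∈-map⁺ var (∈-tabulate⁺ {f = x} e))
      where
      image′ : ∃[ e′ ] σX ρ (var (x e)) ≡ var (x e′)
      image′ = square-edge (σX-edge ρ (square-edge⁻ e))
    σ₊-restricted (ident i) = mk⇔ (λ a∈ → contradiction a∈ ident∉) (λ a∈ → contradiction a∈ ident∉)
      where
      ident∉ : ∀ {n} → ident n ∉ map var (List.tabulate x)
      ident∉ n∈ with ∈-map⁻ var {xs = List.tabulate x} n∈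
      ... | _ , _ , ()

    extension : AutomorphismOn N
    extension = record
      { automorphism = record
        { σN        = σN ρ
        ; σX        = σ₊
        ; σX⁻¹      = extendBy (σX⁻¹ ρ) q
        ; σX-edge   = extendBy-edge {σX ρ} {p} (σX-edge ρ) ∘ edge
        ; σX⁻¹-edge = extendBy-edge {σX⁻¹ ρ} {q} (σX⁻¹-edge ρ) ∘ edge
        ; inverseˡ  = extendBy-inverse {σX ρ} {p} {σX⁻¹ ρ} {q}
                        (σX-edge ρ) (inverseˡ ρ) (λ _ → Perm.inverseˡ (σN ρ)) ∘ edge
        ; inverseʳ  = extendBy-inverse {σX⁻¹ ρ} {q} {σX ρ} {p}
                        (σX⁻¹-edge ρ) (inverseʳ ρ) (λ _ → Perm.inverseʳ (σN ρ)) ∘ edge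
        ; types     = σ₊-types ∘ edge
        }
      ; identifiers-agree = λ n _ → extendBy-ident (σX ρ) p n
      ; restricted-agree  = σ₊-restricted ∘ edge
      }

  has-square : HasHypergraph N (square x)
  has-square = record
    { same   = same-hypergraph
    ; extend = λ ρ → extension ρ , (λ _ → refl) , extendBy-square ρ {σX ρ}
    }

-- The symmetric electoral system for arbitrary distinct channels

proposition5p1 : (x : Fin 4 → Var) → Injective _≡_ _≡_ x →
    Σ[ P ∈ Network 3 ]
    restricted P ≡ tabulate x ×
    OutIsExternal P ×
    ElectoralSystem P ×
    Symmetric P ×
    HasHypergraph P (square x)
proposition5p1 x x-injective =
  square-network , refl ,
  outIsExternal initially good-start ,
  electoralSystem initially good-start (λ { 0F _ () ; 1F _ () ; 2F _ () ; 3F _ () }) ,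
  symmetricWrt , has-square
  where
  -- Binders are numbered from a name fresh for the given channels.
  channels′ = map var (tabulate x)
  x<fresh : ∀ i → x i < fresh channels′
  x<fresh i = fresh-bound channels′ (∈-map⁺ var (∈-tabulate⁺ {f = x} i))
  open Square x x-injective (fresh channels′) x<fresh
  open SquareHypergraph x x-injective (fresh channels′) x<fresh
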